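{- Let $L>3$, let $S\subseteq\mathbb{S}_L$ be a dense subset, and let $a_0,\ldots,a_{n_L}=a_0$ be an orienting loop in $S$. Then the structure $S_L:=(S,B(-,-),(a_i)_{i\le n_L})$ (with one binary relation $B$, where $B(x,y)$ holds iff $d_L(x,y)<1$, and constants for the $a_i$) defines the ternary relations $\{C_{z,t,k}: z,t,k\in\mathbb{Z}\}$ on $S$ and the partial functions $f_z: a\mapsto a+z$ on $S$ (defined at those $a\in S$ with $a+z\in S$), for all $z\in\mathbb{Z}$.
   Context: For real $L\ge2$, the circle of length $L$ is the quotient group $\mathbb{S}_L=(\mathbb{R}/L\mathbb{Z},+_L)$; for $x\in\mathbb{R}$ write $[x]=x+L\mathbb{Z}$, and for $a\in \mathbb{S}_L$, $z\in\mathbb{Z}$ write $a+z$ for $a+_L[z]$. It carries the metric $d_L(a,b)=\min\{|x-y|,L-|x-y|\}$, where $x,y\in[0,L)$ are the unique elements with $[x]=a,[y]=b$. The circular order $C(a,b,c)$ on $\mathbb{S}_L$ holds iff $x<y<z$ or $y<z<x$ or $z<x<y$, where $x,y,z\in[0,L)$ are such that $[x]=a,[y]=b,[z]=c$. For $z,t,k\in\mathbb{Z}$ and $a,b,c\in S$, $C_{z,t,k}(a,b,c)$ holds iff $C(a+z,b+t,c+k)$. For $a,b\in\mathbb{S}_L$, $I(a,b)$ denotes the shorter arc (including end points) in $\mathbb{S}_L$ between $a$ and $b$. For $L>3$ put $n_L:=\lfloor L\rfloor+1$. A sequence $a_0,\ldots,a_{n_L}=a_0$ in $\mathbb{S}_L$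 is an orienting loop if $0<d_L(a_i,a_{i+1})<1$ and $C(a_i,a_{i+1},a_{i+2})$ for all $i$ (indices modulo $n_L$), and $\{I(a_i,a_{i+1})\setminus\{a_i,a_{i+1}\}: i<n_L\}$ forms a partition of $\mathbb{S}_L\setminus\{a_0,\ldots,a_{n_L-1}\}$. -}

module Defs where

open import Level using (0ℓ)
open import Data.Empty using (⊥)
open import Data.Fin using (Fin; inject₁; fromℕ; toℕ)
open import Data.Integer using (ℤ; +_; -[1+_])
open import Data.Nat using (ℕ; zero; suc)
import Data.Nat as ℕ
import Data.Nat.Properties as ℕ
open import Data.Nat.DivMod using (_mod_)
open import Data.Product using (Σ; ∃-syntax; Σ-syntax; _×_; _,_; proj₁)
open import Data.Rational using (ℚ; 0ℚ; 1ℚ; ½)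
import Data.Rational as ℚ
import Data.Rational.Properties as ℚ
open import Data.Rational.Solver using (module +-*-Solver)
open import Data.Sum using (_⊎_; inj₁; inj₂)
open import Data.Vec using (Vec; []; _∷_; lookup)
open import Function using (_∘_)
open import Function.Bundles using (_⇔_)
open import Relation.Binary.Core using (Rel)
open import Relation.Binary.PropositionalEquality using (_≡_; refl; sym; trans; cong; subst; subst₂)
open import Relation.Nullary using (¬_)
open import Relation.Unary using (Pred; _≐_; _∩_; _∖_; ∁; ⋃; Empty; Satisfiable)

------------------------------------------------------------------------
-- Real numbers: Cauchy sequences of rationals with the setoid equality
-- _≈_.  Only the ordered additive group is needed.

IsCauchy : (ℕ → ℚ) → Set
IsCauchy s = ∀ ε → 0ℚ ℚ.< ε →
  ∃[ N ] (∀ m n → N ℕ.≤ m → N ℕ.≤ n → ℚ.∣ s m ℚ.- s n ∣ ℚ.< ε)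

record ℝ : Set where
  constructor mkℝ
  field
    seq      : ℕ → ℚ
    isCauchy : IsCauchy seq

open ℝ public

infix 4 _≈_ _<_ _≤_

_≈_ : Rel ℝ 0ℓ
x ≈ y = ∀ ε → 0ℚ ℚ.< ε → ∃[ N ] (∀ n → N ℕ.≤ n → ℚ.∣ seq x n ℚ.- seq y n ∣ ℚ.< ε)

_<_ : Rel ℝ 0ℓ
x < y = ∃[ ε ] (0ℚ ℚ.< ε × ∃[ N ] (∀ n → N ℕ.≤ n → seq x n ℚ.+ ε ℚ.< seq y n))

_≤_ : Rel ℝ 0ℓ
x ≤ y = ¬ (y < x)

private
  swap-inner : ∀ a b c d → (a ℚ.+ b) ℚ.- (c ℚ.+ d) ≡ (a ℚ.- c) ℚ.+ (b ℚ.- d)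
  swap-inner = solve 4 (λ a b c d → (a :+ b) :- (c :+ d) := (a :- c) :+ (b :- d)) refl
    where open +-*-Solver

  neg-sub : ∀ a b → (ℚ.- a) ℚ.- (ℚ.- b) ≡ ℚ.- (a ℚ.- b)
  neg-sub = solve 2 (λ a b → (:- a) :- (:- b) := :- (a :- b)) refl
    where open +-*-Solver

  cancel-add : ∀ a b → b ℚ.+ (a ℚ.- b) ≡ a
  cancel-add = solve 2 (λ a b → b :+ (a :- b) := a) refl
    where open +-*-Solver

  cancel-sub : ∀ a b → (a ℚ.+ b) ℚ.- a ≡ b
  cancel-sub = solve 2 (λ a b → (a :+ b) :- a := b) refl
    where open +-*-Solver

  neg-swap : ∀ a b → ℚ.- (a ℚ.- b) ≡ b ℚ.- a
  neg-swap = solve 2 (λ a b → :- (a :- b) := b :- a) refl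
    where open +-*-Solver

  neg-neg : ∀ a → ℚ.- (ℚ.- a) ≡ a
  neg-neg = solve 1 (λ a → :- (:- a) := a) refl
    where open +-*-Solver

  p≤∣p∣ : ∀ p → p ℚ.≤ ℚ.∣ p ∣
  p≤∣p∣ p with ℚ.∣p∣≡p∨∣p∣≡-p p | ℚ.0≤∣p∣ p
  ... | inj₁ e | _ = ℚ.≤-reflexive (sym e)
  ... | inj₂ e | h = ℚ.≤-trans
    (subst (ℚ._≤ 0ℚ) (trans (cong ℚ.-_ e) (neg-neg p)) (ℚ.neg-antimono-≤ h)) h

  ∣∣-swap : ∀ a b → ℚ.∣ a ℚ.- b ∣ ≡ ℚ.∣ b ℚ.- a ∣
  ∣∣-swap a b = trans (sym (ℚ.∣-p∣≡∣p∣ (a ℚ.- b))) (cong ℚ.∣_∣ (neg-swap a b))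

  ⊔-bound : ∀ a b c d {e} → ℚ.∣ a ℚ.- c ∣ ℚ.≤ e → ℚ.∣ b ℚ.- d ∣ ℚ.≤ e →
            (a ℚ.⊔ b) ℚ.- (c ℚ.⊔ d) ℚ.≤ e
  ⊔-bound a b c d {e} h k = subst ((a ℚ.⊔ b) ℚ.- (c ℚ.⊔ d) ℚ.≤_) (cancel-sub (c ℚ.⊔ d) e)
    (ℚ.+-monoˡ-≤ (ℚ.- (c ℚ.⊔ d)) (ℚ.⊔-lub (below a c (ℚ.p≤p⊔q c d) h) (below b d (ℚ.p≤q⊔p c d) k)))
    where
    below : ∀ p q → q ℚ.≤ c ℚ.⊔ d → ℚ.∣ p ℚ.- q ∣ ℚ.≤ e → p ℚ.≤ (c ℚ.⊔ d) ℚ.+ e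
    below p q q≤ pq≤ = subst (ℚ._≤ (c ℚ.⊔ d) ℚ.+ e) (cancel-add p q)
      (ℚ.+-mono-≤ q≤ (ℚ.≤-trans (p≤∣p∣ (p ℚ.- q)) pq≤))

  Lipschitz : (ℚ → ℚ → ℚ) → Set
  Lipschitz f = ∀ a b c d → ℚ.∣ f a b ℚ.- f c d ∣ ℚ.≤ ℚ.∣ a ℚ.- c ∣ ℚ.+ ℚ.∣ b ℚ.- d ∣

  +-lipschitz : Lipschitz ℚ._+_
  +-lipschitz a b c d = subst (λ q → ℚ.∣ q ∣ ℚ.≤ ℚ.∣ a ℚ.- c ∣ ℚ.+ ℚ.∣ b ℚ.- d ∣)
    (sym (swap-inner a b c d)) (ℚ.∣p+q∣≤∣p∣+∣q∣ (a ℚ.- c) (b ℚ.- d))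

  left : ∀ p q → ℚ.∣ p ∣ ℚ.≤ ℚ.∣ p ∣ ℚ.+ ℚ.∣ q ∣
  left p q = subst (ℚ._≤ ℚ.∣ p ∣ ℚ.+ ℚ.∣ q ∣)
    (ℚ.+-identityʳ ℚ.∣ p ∣) (ℚ.+-monoʳ-≤ ℚ.∣ p ∣ (ℚ.0≤∣p∣ q))

  right : ∀ p q → ℚ.∣ q ∣ ℚ.≤ ℚ.∣ p ∣ ℚ.+ ℚ.∣ q ∣
  right p q = subst (ℚ._≤ ℚ.∣ p ∣ ℚ.+ ℚ.∣ q ∣)
    (ℚ.+-identityˡ ℚ.∣ q ∣) (ℚ.+-monoˡ-≤ ℚ.∣ q ∣ (ℚ.0≤∣p∣ p))

  ⊔-lipschitz : Lipschitz ℚ._⊔_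
  ⊔-lipschitz a b c d with ℚ.∣p∣≡p∨∣p∣≡-p ((a ℚ.⊔ b) ℚ.- (c ℚ.⊔ d))
  ... | inj₁ e = subst (ℚ._≤ ℚ.∣ a ℚ.- c ∣ ℚ.+ ℚ.∣ b ℚ.- d ∣) (sym e)
    (⊔-bound a b c d (left (a ℚ.- c) (b ℚ.- d)) (right (a ℚ.- c) (b ℚ.- d)))
  ... | inj₂ e = subst (ℚ._≤ ℚ.∣ a ℚ.- c ∣ ℚ.+ ℚ.∣ b ℚ.- d ∣)
    (sym (trans e (neg-swap (a ℚ.⊔ b) (c ℚ.⊔ d))))
    (⊔-bound c d a b
      (subst (ℚ._≤ ℚ.∣ a ℚ.- c ∣ ℚ.+ ℚ.∣ b ℚ.- d ∣) (∣∣-swap a c) (left (a ℚ.- c) (b ℚ.- d)))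
      (subst (ℚ._≤ ℚ.∣ a ℚ.- c ∣ ℚ.+ ℚ.∣ b ℚ.- d ∣) (∣∣-swap b d) (right (a ℚ.- c) (b ℚ.- d))))

  half-pos : ∀ ε → 0ℚ ℚ.< ε → 0ℚ ℚ.< ½ ℚ.* ε
  half-pos ε ε>0 = ℚ.positive⁻¹ (½ ℚ.* ε) {{ℚ.pos*pos⇒pos ½ ε {{ℚ.positive ε>0}}}}

  half+half : ∀ ε → (½ ℚ.* ε) ℚ.+ (½ ℚ.* ε) ≡ ε
  half+half ε = trans (sym (ℚ.*-distribʳ-+ ε ½ ½)) (ℚ.*-identityˡ ε)

  pointwise-isCauchy : ∀ f → Lipschitz f → ∀ x y → IsCauchy (λ n → f (seq x n) (seq y n))
  pointwise-isCauchy f lip x y ε ε>0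
    with isCauchy x (½ ℚ.* ε) (half-pos ε ε>0) | isCauchy y (½ ℚ.* ε) (half-pos ε ε>0)
  ... | M , hx | N , hy = M ℕ.⊔ N , λ m n m≥ n≥ → ℚ.≤-<-trans
    (lip (seq x m) (seq y m) (seq x n) (seq y n))
    (subst (_ ℚ.<_) (half+half ε)
      (ℚ.+-mono-< (hx m n (ℕ.≤-trans (ℕ.m≤m⊔n M N) m≥) (ℕ.≤-trans (ℕ.m≤m⊔n M N) n≥))
                  (hy m n (ℕ.≤-trans (ℕ.m≤n⊔m M N) m≥) (ℕ.≤-trans (ℕ.m≤n⊔m M N) n≥))))

  neg-isCauchy : ∀ x → IsCauchy (λ n → ℚ.- seq x n)
  neg-isCauchy x ε ε>0 with isCauchy x ε ε>0
  ... | N , h = N , λ m n m≥ n≥ → subst (ℚ._< ε)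
    (sym (trans (cong ℚ.∣_∣ (neg-sub (seq x m) (seq x n))) (ℚ.∣-p∣≡∣p∣ (seq x m ℚ.- seq x n))))
    (h m n m≥ n≥)

  const-isCauchy : ∀ q → IsCauchy (λ _ → q)
  const-isCauchy q ε ε>0 = 0 , λ _ _ _ _ → subst (ℚ._< ε)
    (sym (cong ℚ.∣_∣ (ℚ.+-inverseʳ q))) ε>0

infixl 6 _+_ _-_
infixl 6 _⊔_ _⊓_
infixl 7 _·_
infix  8 -_

fromℚ : ℚ → ℝ
fromℚ q = mkℝ (λ _ → q) (const-isCauchy q)

fromℤ : ℤ → ℝ
fromℤ z = fromℚ (z ℚ./ 1)

_+_ : ℝ → ℝ → ℝ
x + y = mkℝ (λ n → seq x n ℚ.+ seq y n) (pointwise-isCauchy ℚ._+_ +-lipschitz x y)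

-_ : ℝ → ℝ
- x = mkℝ (λ n → ℚ.- seq x n) (neg-isCauchy x)

_-_ : ℝ → ℝ → ℝ
x - y = x + (- y)

_⊔_ : ℝ → ℝ → ℝ
x ⊔ y = mkℝ (λ n → seq x n ℚ.⊔ seq y n) (pointwise-isCauchy ℚ._⊔_ ⊔-lipschitz x y)

_⊓_ : ℝ → ℝ → ℝ
x ⊓ y = - ((- x) ⊔ (- y))

∣_∣ : ℝ → ℝ
∣ x ∣ = x ⊔ (- x)

0ℝ 1ℝ : ℝ
0ℝ = fromℚ 0ℚ
1ℝ = fromℚ 1ℚ

_·_ : ℤ → ℝ → ℝ
(+ zero)       · x = 0ℝ
(+ suc n)      · x = x + (+ n) · x
-[1+ zero ]    · x = - x
-[1+ suc n ]   · x = (- x) + -[1+ n ] · x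

_IsFloorOf_ : ℕ → ℝ → Set
m IsFloorOf x = fromℤ (+ m) ≤ x × x < fromℤ (+ suc m)

------------------------------------------------------------------------
-- The circle of length L.  A point [x] is given by any real x; equality
-- of points is congruence modulo Lℤ, and +_L is addition of reals.

module _ (L : ℝ) where

  SamePoint : Rel ℝ 0ℓ
  SamePoint a b = ∃[ k ] (a - b ≈ k · L)

  -- x is the representative of the point a in [0,L)
  Represents : ℝ → ℝ → Set
  Represents x a = 0ℝ ≤ x × x < L × SamePoint x a

  -- Dist a b r says d_L(a,b) = r.  The representatives in [0,L) are not a
  -- computable function of the point, hence a relation; likewise for C.
  Dist : ℝ → ℝ → ℝ → Set
  Dist a b r = ∃[ x ] ∃[ y ] (Represents x a × Represents y b ×
    r ≈ ∣ x - y ∣ ⊓ (L - ∣ x - y ∣))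

  Near : Rel ℝ 0ℓ
  Near a b = ∃[ r ] (Dist a b r × r < 1ℝ)

  C : ℝ → ℝ → ℝ → Set
  C a b c = ∃[ x ] ∃[ y ] ∃[ z ]
    (Represents x a × Represents y b × Represents z c ×
     ((x < y × y < z) ⊎ (y < z × z < x) ⊎ (z < x × x < y)))

  shift : ℤ → ℝ → ℝ
  shift z a = a + fromℤ z

  Dense : Pred ℝ 0ℓ → Set
  Dense S = ∀ a ε → 0ℝ < ε → ∃[ s ] (S s × ∃[ r ] (Dist a s r × r < ε))

  -- The closed arc of length ℓ running from a in the positive direction to b.
  PositiveArc : ℝ → ℝ → ℝ → Pred ℝ 0ℓ
  PositiveArc ℓ a b c = SamePoint b (a + ℓ) ×
    ∃[ t ] (0ℝ ≤ t × t ≤ ℓ × SamePoint c (a + t))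

  -- I(a,b): the arc with end points a, b whose length ℓ satisfies ℓ ≤ L - ℓ.
  -- For antipodal a, b both arcs qualify and I a b is their union.
  I : ℝ → ℝ → Pred ℝ 0ℓ
  I a b c = ∃[ ℓ ] (0ℝ ≤ ℓ × ℓ ≤ L - ℓ × (PositiveArc ℓ a b c ⊎ PositiveArc ℓ b a c))

  OpenArc : ℝ → ℝ → Pred ℝ 0ℓ
  OpenArc a b = I a b ∖ (λ c → SamePoint c a ⊎ SamePoint c b)

-- The set of sets { P i : i } is a partition of X; repetitions among the
-- P i are therefore allowed.
IsPartition : {A J : Set} → (J → Pred A 0ℓ) → Pred A 0ℓ → Set
IsPartition {J = J} P X =
  (∀ i → Satisfiable (P i)) ×
  (∀ i j → P i ≐ P j ⊎ Empty (P i ∩ P j)) ×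
  ⋃ J P ≐ X

-- Here n = suc m is the number of steps and a lists a_0, …, a_n.
module _ (L : ℝ) (m : ℕ) (a : Fin (suc (suc m)) → ℝ) where

  private
    n = suc m

  -- a_i with the index i read modulo n
  cyclic : ℕ → ℝ
  cyclic i = a (inject₁ (i mod n))

  record OrientingLoop : Set where
    field
      closed    : SamePoint L (a (fromℕ n)) (cyclic 0)
      steps     : ∀ i → ∃[ r ] (Dist L (cyclic i) (cyclic (1 ℕ.+ i)) r × 0ℝ < r × r < 1ℝ)
      oriented  : ∀ i → C L (cyclic i) (cyclic (1 ℕ.+ i)) (cyclic (2 ℕ.+ i))
      partition : IsPartition {J = Fin n}
        (λ i → OpenArc L (cyclic (toℕ i)) (cyclic (1 ℕ.+ toℕ i)))
        (∁ (λ x → ∃[ j ] SamePoint L x (cyclic (toℕ {n} j))))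

------------------------------------------------------------------------
-- First-order logic with equality, one binary relation symbol and a set
-- Con of constant symbols.  Formula Con k has k free (de Bruijn) variables.

data Term (Con : Set) (k : ℕ) : Set where
  var : Fin k → Term Con k
  con : Con → Term Con k

data Formula (Con : Set) (k : ℕ) : Set where
  eqF relF          : Term Con k → Term Con k → Formula Con k
  falseF            : Formula Con k
  andF orF impF     : Formula Con k → Formula Con k → Formula Con k
  allF exF          : Formula Con (suc k) → Formula Con k

record Structure (Con : Set) : Set₁ where
  field
    Carrier  : Set
    Equal    : Rel Carrier 0ℓ
    Related  : Rel Carrier 0ℓ
    constant : Con → Carrier

module _ {Con : Set} (M : Structure Con) where
  open Structure M

  ⟦_⟧ : ∀ {k} → Term Con k → Vec Carrier k → Carrier
  ⟦ var i ⟧ v = lookup v i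
  ⟦ con c ⟧ v = constant c

  Satisfies : ∀ {k} → Vec Carrier k → Formula Con k → Set
  Satisfies v (eqF s t)  = Equal (⟦ s ⟧ v) (⟦ t ⟧ v)
  Satisfies v (relF s t) = Related (⟦ s ⟧ v) (⟦ t ⟧ v)
  Satisfies v falseF     = ⊥
  Satisfies v (andF φ ψ) = Satisfies v φ × Satisfies v ψ
  Satisfies v (orF φ ψ)  = Satisfies v φ ⊎ Satisfies v ψ
  Satisfies v (impF φ ψ) = Satisfies v φ → Satisfies v ψ
  Satisfies v (allF φ)   = ∀ x → Satisfies (x ∷ v) φ
  Satisfies v (exF φ)    = ∃[ x ] Satisfies (x ∷ v) φ

  -- Definability without parameters other than the named constants.
  Definable : ∀ k → Pred (Vec Carrier k) 0ℓ → Set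
  Definable k R = ∃[ φ ] (∀ v → Satisfies {k} v φ ⇔ R v)

module _ (L : ℝ) (S : Pred ℝ 0ℓ) where

  structure-S_L : {Con : Set} → (Con → Σ ℝ S) → Structure Con
  structure-S_L a = record
    { Carrier  = Σ ℝ S
    ; Equal    = λ x y → SamePoint L (proj₁ x) (proj₁ y)
    ; Related  = λ x y → Near L (proj₁ x) (proj₁ y)
    ; constant = a
    }

  C[_,_,_] : ℤ → ℤ → ℤ → Pred (Vec (Σ ℝ S) 3) 0ℓ
  C[ z , t , k ] ((a , _) ∷ (b , _) ∷ (c , _) ∷ []) = C L (shift L z a) (shift L t b) (shift L k c)

  -- The graph { (a , b) ∈ S × S : b = a + z } of the partial function f_z.
  f-graph : ℤ → Pred (Vec (Σ ℝ S) 2) 0ℓ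
  f-graph z ((a , _) ∷ (b , _) ∷ []) = SamePoint L b (shift L z a)

{-# OPTIONS --safe #-}

-- Write B for the relation d < 1.  Orientation is transported along paths: if B(x,y) and y < z < y + 1, then
-- x < y whenever z is not near x, because otherwise x would lie in [y, y + 1), within distance 1 of z; the same
-- holds for predecessors.  Starting from two consecutive points of the loop, a bounded number of such steps
-- (bounded because the circle is covered by finitely many arcs of length 1) reaches all pairs, so the relation
-- "y lies in the open arc (x, x + 1)" is definable.  From it the arcs (x + n, x + n + 1) and then the
-- points x + n are definable by induction on n: for x + n + 1 < b < x + n + 2 one asks for d and e in
-- (x + n, x + n + 1) with b in (d, d + 1) and b not near e.  Negative shifts are converses of positive ones.
-- Finally C(a, b, c) holds iff there are positive s₁, s₂, s₃ leading from a to b, from b to c and from c back to a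
-- with s₁ + s₂ + s₃ < 2L (so the sum is L); since L > 3, it suffices to know each sᵢ up to an interval
-- (n, n + 1], provided the lower ends add up to less than L.

module Submission where

open import Defs
open import Level using (0ℓ)
open import Axiom.ExcludedMiddle using (ExcludedMiddle)
open import Data.Bool using (Bool; true; false; T; _∧_)
open import Data.Bool.Properties using (T-∧)
open import Data.Empty using (⊥; ⊥-elim)
open import Data.Fin using (Fin; zero; suc; inject₁)
open import Data.Integer using (ℤ; +_; -[1+_])
import Data.Integer as ℤ
import Data.Integer.Properties as ℤ
open import Data.List using (List; []; _∷_; _++_; replicate)
open import Data.Nat using (ℕ; zero; suc)
import Data.Nat as ℕ
import Data.Nat.Properties as ℕ
open import Data.Nat.DivMod using (_mod_)
open import Data.Product using (Σ; ∃-syntax; _×_; _,_; proj₁; proj₂; map₂)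
open import Data.Product.Function.NonDependent.Propositional using (_×-⇔_)
open import Data.Rational using (ℚ; 0ℚ; 1ℚ; ½)
import Data.Rational as ℚ
import Data.Rational.Properties as ℚ
open import Data.Rational.Solver using (module +-*-Solver)
import Data.Rational.Unnormalised as ℚᵘ
import Data.Rational.Unnormalised.Properties as ℚᵘ
open import Data.Sum using (_⊎_; inj₁; inj₂) renaming (map₂ to map₂⊎)
open import Data.Sum.Function.Propositional using (_⊎-⇔_)
open import Data.Unit using (⊤; tt)
open import Data.Vec using (Vec; []; _∷_; lookup; allFin; map)
import Data.Vec as Vec
open import Data.Vec.N-ary using (N-ary; _$ⁿ_)
open import Function using (_∘_; id; flip; case_of_)
open import Function.Bundles using (Equivalence; _⇔_; mk⇔)
open import Relation.Binary.Core using (Rel)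
open import Relation.Binary.Definitions using (_Respects_)
open import Relation.Binary.PropositionalEquality
  using (_≡_; refl; sym; trans; cong; cong₂; subst; subst₂)
open import Relation.Nullary using (¬_; yes; no)
open import Relation.Nullary.Decidable using (⌊_⌋; toWitness)
open import Relation.Unary using (Pred)

open Equivalence using (to; from)
open +-*-Solver using (solve; con; _:=_; _:+_; _:-_; :-_; _:*_)

-- The ordered additive group of Cauchy reals

-- `B` is symmetric and invariant under reflections of the circle, so only the constants can tell
-- the two directions apart. This is why a directed arc, and not the order `C`, is the first
-- relation to be defined, and why it grows out of one pair of constants. One formula of fixed depth
-- must serve for all pairs; the Archimedean property bounds that depth. A second obstacle is that
-- `S` need not be closed under adding 1. No quantifier reaches a missing point x + n, so arcs based
-- there are described through points of `S` inside them. Density supplies such points only in open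
-- intervals, hence every witness is chosen under strict inequalities; the points x + n themselves,
-- given by an equation, are caught as what two adjacent open arcs leave out. Nearness is usable in
-- both directions because L > 3 keeps an offset in [1, 2) from being congruent to one in (-1, 1).
-- Excluded middle compares reals, and it decides the numerical side conditions, which enter
-- formulas only as true or false.

fromℤℚ : ℤ → ℚ
fromℤℚ i = i ℚ./ 1

fromℤℚ-+ : ∀ i j → fromℤℚ (i ℤ.+ j) ≡ fromℤℚ i ℚ.+ fromℤℚ j
fromℤℚ-+ i j = ℚ.toℚᵘ-injective (begin
  ℚ.toℚᵘ (fromℤℚ (i ℤ.+ j))                     ≈⟨ ℚ.toℚᵘ-fromℚᵘ _ ⟩
  ℚᵘ.mkℚᵘ (i ℤ.+ j) 0                           ≈⟨ ℚᵘ.*≡* (cong (ℤ._* + 1) (cong₂ ℤ._+_ (sym (ℤ.*-identityʳ i)) (sym (ℤ.*-identityʳ j)))) ⟩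
  ℚᵘ.mkℚᵘ i 0 ℚᵘ.+ ℚᵘ.mkℚᵘ j 0                  ≈⟨ ℚᵘ.+-cong (ℚ.toℚᵘ-fromℚᵘ (ℚᵘ.mkℚᵘ i 0)) (ℚ.toℚᵘ-fromℚᵘ (ℚᵘ.mkℚᵘ j 0)) ⟨
  ℚ.toℚᵘ (fromℤℚ i) ℚᵘ.+ ℚ.toℚᵘ (fromℤℚ j)      ≈⟨ ℚ.toℚᵘ-homo-+ (fromℤℚ i) (fromℤℚ j) ⟨
  ℚ.toℚᵘ (fromℤℚ i ℚ.+ fromℤℚ j)                ∎)
  where open ℚᵘ.≃-Reasoning

fromℤℚ-neg : ∀ i → fromℤℚ (ℤ.- i) ≡ ℚ.- fromℤℚ i
fromℤℚ-neg i = ℚ.toℚᵘ-injective (begin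
  ℚ.toℚᵘ (fromℤℚ (ℤ.- i))   ≈⟨ ℚ.toℚᵘ-fromℚᵘ _ ⟩
  ℚᵘ.- ℚᵘ.mkℚᵘ i 0          ≈⟨ ℚᵘ.-‿cong (ℚ.toℚᵘ-fromℚᵘ (ℚᵘ.mkℚᵘ i 0)) ⟨
  ℚᵘ.- ℚ.toℚᵘ (fromℤℚ i)    ≈⟨ ℚ.toℚᵘ-homo‿- (fromℤℚ i) ⟨
  ℚ.toℚᵘ (ℚ.- fromℤℚ i)     ∎)
  where open ℚᵘ.≃-Reasoning

halve : ∀ {ε} → 0ℚ ℚ.< ε → ∃[ δ ] (0ℚ ℚ.< δ × δ ℚ.+ δ ≡ ε)
halve {ε} ε>0 = ½ ℚ.* ε ,
  ℚ.positive⁻¹ (½ ℚ.* ε) {{ℚ.pos*pos⇒pos ½ ε {{ℚ.positive ε>0}}}} ,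
  trans (sym (ℚ.*-distribʳ-+ ε ½ ½)) (ℚ.*-identityˡ ε)

∣p-q∣<ε⇒p<q+ε : ∀ p q {ε} → ℚ.∣ p ℚ.- q ∣ ℚ.< ε → p ℚ.< q ℚ.+ ε
∣p-q∣<ε⇒p<q+ε p q h = subst (ℚ._< q ℚ.+ _)
  (solve 2 (λ p q → q :+ (p :- q) := p) refl p q)
  (ℚ.+-monoʳ-< q (ℚ.≤-<-trans (p≤∣p∣ (p ℚ.- q)) h))
  where
  p≤∣p∣ : ∀ p → p ℚ.≤ ℚ.∣ p ∣
  p≤∣p∣ p with ℚ.≤-total 0ℚ p
  ... | inj₁ 0≤p = ℚ.≤-reflexive (sym (ℚ.0≤p⇒∣p∣≡p 0≤p))
  ... | inj₂ p≤0 = ℚ.≤-trans p≤0 (ℚ.0≤∣p∣ p)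

∣p-q∣<ε⇒q<p+ε : ∀ p q {ε} → ℚ.∣ p ℚ.- q ∣ ℚ.< ε → q ℚ.< p ℚ.+ ε
∣p-q∣<ε⇒q<p+ε p q {ε} h = ∣p-q∣<ε⇒p<q+ε q p (subst (ℚ._< ε)
  (trans (sym (ℚ.∣-p∣≡∣p∣ (p ℚ.- q))) (cong ℚ.∣_∣ (solve 2 (λ p q → :- (p :- q) := q :- p) refl p q))) h)

<⇒∣p-q∣<ε : ∀ p q {ε} → p ℚ.< q ℚ.+ ε → q ℚ.< p ℚ.+ ε → ℚ.∣ p ℚ.- q ∣ ℚ.< ε
<⇒∣p-q∣<ε p q {ε} h k with ℚ.∣p∣≡p∨∣p∣≡-p (p ℚ.- q)
... | inj₁ e = subst₂ ℚ._<_ (sym e) (solve 2 (λ q ε → q :+ ε :- q := ε) refl q ε) (ℚ.+-monoˡ-< (ℚ.- q) h)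
... | inj₂ e = subst₂ ℚ._<_
  (trans (solve 2 (λ p q → q :- p := :- (p :- q)) refl p q) (sym e))
  (solve 2 (λ p ε → p :+ ε :- p := ε) refl p ε) (ℚ.+-monoˡ-< (ℚ.- p) k)

Eventually : (ℕ → Set) → Set
Eventually P = ∃[ N ] (∀ n → N ℕ.≤ n → P n)

always : ∀ {P} → (∀ n → P n) → Eventually P
always p = 0 , λ n _ → p n

eventually-map : ∀ {P Q} → (∀ n → P n → Q n) → Eventually P → Eventually Q
eventually-map f (N , p) = N , λ n n≥ → f n (p n n≥)

eventually-zip : ∀ {P Q R} → (∀ n → P n → Q n → R n) → Eventually P → Eventually Q → Eventually R
eventually-zip f (M , p) (N , q) = M ℕ.⊔ N , λ n n≥ →
  f n (p n (ℕ.≤-trans (ℕ.m≤m⊔n M N) n≥)) (q n (ℕ.≤-trans (ℕ.m≤n⊔m M N) n≥))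

eventually-const : ∀ {P : Set} → Eventually (λ _ → P) → P
eventually-const (N , p) = p N ℕ.≤-refl

-- A positive (and pointwise) form of ≤, which the definition states as a negation.
infix 4 _≲_
_≲_ : ℝ → ℝ → Set
x ≲ y = ∀ ε → 0ℚ ℚ.< ε → Eventually (λ n → seq x n ℚ.< seq y n ℚ.+ ε)

≲⇒≤ : ∀ {x y} → x ≲ y → x ≤ y
≲⇒≤ x≲y (ε , ε>0 , y+ε<x) = eventually-const
  (eventually-zip (λ _ → ℚ.<-asym) y+ε<x (x≲y ε ε>0))

+-cancelʳ-< : ∀ r {p q} → p ℚ.+ r ℚ.< q ℚ.+ r → p ℚ.< q
+-cancelʳ-< r {p} {q} h = subst₂ ℚ._<_ (cancel p) (cancel q) (ℚ.+-monoˡ-< (ℚ.- r) h)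
  where
  cancel : ∀ p → p ℚ.+ r ℚ.- r ≡ p
  cancel p = solve 2 (λ p r → p :+ r :- r := p) refl p r

-- If one late term of `x` exceeded that of `y` by `ε`, the Cauchy property with modulus `η`, a
-- quarter of `ε`, would keep all later terms apart by `ε` minus two `η`, which is `δ`. That is
-- `y < x`.
≤⇒≲ : ∀ {x y} → x ≤ y → x ≲ y
≤⇒≲ {x} {y} x≤y ε ε>0 with halve ε>0
... | δ , δ>0 , δ+δ≡ε with halve δ>0
... | η , η>0 , η+η≡δ with isCauchy x η η>0 | isCauchy y η η>0
... | M , cx | N , cy = M ℕ.⊔ N , close
  where
  M≤ : ∀ {n} → M ℕ.⊔ N ℕ.≤ n → M ℕ.≤ n
  M≤ = ℕ.≤-trans (ℕ.m≤m⊔n M N)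
  N≤ : ∀ {n} → M ℕ.⊔ N ℕ.≤ n → N ℕ.≤ n
  N≤ = ℕ.≤-trans (ℕ.m≤n⊔m M N)
  ε-split : ∀ y → y ℚ.+ η ℚ.+ (δ ℚ.+ η) ≡ y ℚ.+ ε
  ε-split y = trans (solve 3 (λ y δ η → y :+ η :+ (δ :+ η) := y :+ (δ :+ (η :+ η))) refl y δ η)
    (cong (y ℚ.+_) (trans (cong (δ ℚ.+_) η+η≡δ) δ+δ≡ε))
  close : ∀ n → M ℕ.⊔ N ℕ.≤ n → seq x n ℚ.< seq y n ℚ.+ ε
  close n n≥ with seq x n ℚ.<? seq y n ℚ.+ ε
  ... | yes h = h
  ... | no h = ⊥-elim (x≤y (δ , δ>0 , M ℕ.⊔ N , λ m m≥ → +-cancelʳ-< η (begin-strict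
    seq y m ℚ.+ δ ℚ.+ η                ≡⟨ ℚ.+-assoc (seq y m) δ η ⟩
    seq y m ℚ.+ (δ ℚ.+ η)              <⟨ ℚ.+-monoˡ-< (δ ℚ.+ η) (∣p-q∣<ε⇒p<q+ε (seq y m) (seq y n) (cy m n (N≤ m≥) (N≤ n≥))) ⟩
    seq y n ℚ.+ η ℚ.+ (δ ℚ.+ η)        ≡⟨ ε-split (seq y n) ⟩
    seq y n ℚ.+ ε                      ≤⟨ ℚ.≮⇒≥ h ⟩
    seq x n                            <⟨ ∣p-q∣<ε⇒p<q+ε (seq x n) (seq x m) (cx n m (M≤ n≥) (M≤ m≥)) ⟩
    seq x m ℚ.+ η                      ∎)))
    where open ℚ.≤-Reasoning

≈⇒≲ : ∀ {x y} → x ≈ y → x ≲ y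
≈⇒≲ {x} {y} x≈y ε ε>0 = eventually-map (λ n → ∣p-q∣<ε⇒p<q+ε (seq x n) (seq y n)) (x≈y ε ε>0)

≈⇒≳ : ∀ {x y} → x ≈ y → y ≲ x
≈⇒≳ {x} {y} x≈y ε ε>0 = eventually-map (λ n → ∣p-q∣<ε⇒q<p+ε (seq x n) (seq y n)) (x≈y ε ε>0)

≲-antisym : ∀ {x y} → x ≲ y → y ≲ x → x ≈ y
≲-antisym {x} {y} x≲y y≲x ε ε>0 =
  eventually-zip (λ n → <⇒∣p-q∣<ε (seq x n) (seq y n)) (x≲y ε ε>0) (y≲x ε ε>0)

≈-sym : ∀ {x y} → x ≈ y → y ≈ x
≈-sym {x} {y} x≈y = ≲-antisym {y} {x} (≈⇒≳ {x} {y} x≈y) (≈⇒≲ {x} {y} x≈y)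

≤-antisym : ∀ {x y} → x ≤ y → y ≤ x → x ≈ y
≤-antisym {x} {y} x≤y y≤x = ≲-antisym {x} {y} (≤⇒≲ {x} {y} x≤y) (≤⇒≲ {y} {x} y≤x)

≡⇒≈ : ∀ {x y} → (∀ n → seq x n ≡ seq y n) → x ≈ y
≡⇒≈ {x} {y} e ε ε>0 = always λ n → subst (ℚ._< ε)
  (sym (trans (cong (λ q → ℚ.∣ q ℚ.- seq y n ∣) (e n)) (cong ℚ.∣_∣ (ℚ.+-inverseʳ (seq y n))))) ε>0

p<p+ε : ∀ p {ε} → 0ℚ ℚ.< ε → p ℚ.< p ℚ.+ ε
p<p+ε p {ε} ε>0 = subst (ℚ._< p ℚ.+ ε) (ℚ.+-identityʳ p) (ℚ.+-monoʳ-< p ε>0)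

<⇒≤ : ∀ {x y} → x < y → x ≤ y
<⇒≤ {x} {y} (ε , ε>0 , x+ε<y) (δ , δ>0 , y+δ<x) = eventually-const (eventually-zip
  (λ n h k → ℚ.<-asym
    (ℚ.<-trans (p<p+ε (seq x n) ε>0) h) (ℚ.<-trans (p<p+ε (seq y n) δ>0) k))
  x+ε<y y+δ<x)

infix 4 _≐_
-- Equality, congruence and both inequalities depend on a pair only through its difference; this is
-- how a sum of hypotheses is carried over to a differently written goal.
_≐_ : ℝ × ℝ → ℝ × ℝ → Set
(x , y) ≐ (x′ , y′) = ∀ n → seq x n ℚ.- seq y n ≡ seq x′ n ℚ.- seq y′ n

≈-resp : ∀ {x y x′ y′} → (x , y) ≐ (x′ , y′) → x ≈ y → x′ ≈ y′
≈-resp d x≈y ε ε>0 = eventually-map (λ n → subst (λ q → ℚ.∣ q ∣ ℚ.< ε) (d n)) (x≈y ε ε>0)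

translate : ∀ p q p′ q′ ε δ → p ℚ.- q ≡ p′ ℚ.- q′ → p ℚ.+ ε ℚ.< q ℚ.+ δ → p′ ℚ.+ ε ℚ.< q′ ℚ.+ δ
translate p q p′ q′ ε δ d h = subst₂ ℚ._<_
  (solve 3 (λ p p′ ε → p :+ ε :+ (p′ :- p) := p′ :+ ε) refl p p′ ε)
  (trans (solve 4 (λ p q p′ δ → q :+ δ :+ (p′ :- p) := p′ :- (p :- q) :+ δ) refl p q p′ δ)
  (trans (cong (λ e → p′ ℚ.- e ℚ.+ δ) d) (solve 3 (λ p′ q′ δ → p′ :- (p′ :- q′) :+ δ := q′ :+ δ) refl p′ q′ δ)))
  (ℚ.+-monoˡ-< (p′ ℚ.- p) h)

≲-resp : ∀ {x y x′ y′} → (x , y) ≐ (x′ , y′) → x ≲ y → x′ ≲ y′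
≲-resp {x} {y} {x′} {y′} d x≲y ε ε>0 = eventually-map
  (λ n h → subst (ℚ._< seq y′ n ℚ.+ ε) (ℚ.+-identityʳ (seq x′ n))
    (translate (seq x n) (seq y n) (seq x′ n) (seq y′ n) 0ℚ ε (d n)
      (subst (ℚ._< seq y n ℚ.+ ε) (sym (ℚ.+-identityʳ (seq x n))) h))) (x≲y ε ε>0)

<-resp : ∀ {x y x′ y′} → (x , y) ≐ (x′ , y′) → x < y → x′ < y′
<-resp {x} {y} {x′} {y′} d (ε , ε>0 , x+ε<y) = ε , ε>0 , eventually-map
  (λ n h → subst (seq x′ n ℚ.+ ε ℚ.<_) (ℚ.+-identityʳ (seq y′ n))
    (translate (seq x n) (seq y n) (seq x′ n) (seq y′ n) ε 0ℚ (d n)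
      (subst (seq x n ℚ.+ ε ℚ.<_) (sym (ℚ.+-identityʳ (seq y n))) h))) x+ε<y

interchange : ∀ p q r s → (p ℚ.+ q) ℚ.+ (r ℚ.+ s) ≡ (p ℚ.+ r) ℚ.+ (q ℚ.+ s)
interchange = solve 4 (λ p q r s → (p :+ q) :+ (r :+ s) := (p :+ r) :+ (q :+ s)) refl

+-mono-< : ∀ {x y x′ y′} → x < y → x′ < y′ → x + x′ < y + y′
+-mono-< {x} {y} {x′} {y′} (ε , ε>0 , x+ε<y) (δ , δ>0 , x′+δ<y′) =
  ε ℚ.+ δ , ℚ.+-mono-< ε>0 δ>0 , eventually-zip
    (λ n h k → subst (ℚ._< _) (interchange (seq x n) ε (seq x′ n) δ) (ℚ.+-mono-< h k)) x+ε<y x′+δ<y′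

+-mono-<-≲ : ∀ {x y x′ y′} → x < y → x′ ≲ y′ → x + x′ < y + y′
+-mono-<-≲ {x} {y} {x′} {y′} (ε , ε>0 , x+ε<y) x′≲y′ with halve ε>0
... | δ , δ>0 , δ+δ≡ε = δ , δ>0 , eventually-zip
  (λ n h k → +-cancelʳ-< δ (subst₂ ℚ._<_
    (trans (cong (λ e → seq x n ℚ.+ e ℚ.+ seq x′ n) (sym δ+δ≡ε))
      (solve 3 (λ x x′ δ → x :+ (δ :+ δ) :+ x′ := x :+ x′ :+ δ :+ δ) refl (seq x n) (seq x′ n) δ))
    (sym (ℚ.+-assoc (seq y n) (seq y′ n) δ)) (ℚ.+-mono-< h k))) x+ε<y (x′≲y′ δ δ>0)

+-mono-≲ : ∀ {x y x′ y′} → x ≲ y → x′ ≲ y′ → x + x′ ≲ y + y′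
+-mono-≲ {x} {y} {x′} {y′} x≲y x′≲y′ ε ε>0 with halve ε>0
... | δ , δ>0 , refl = eventually-zip
  (λ n h k → subst (_ ℚ.<_) (interchange (seq y n) δ (seq y′ n) δ) (ℚ.+-mono-< h k))
  (x≲y δ δ>0) (x′≲y′ δ δ>0)

-- The action of the integers is defined by repeated addition. Termwise it is a product of
-- rationals, which yields additivity in `k` and thereby the addition of congruences.
seq-· : ∀ k x n → seq (k · x) n ≡ fromℤℚ k ℚ.* seq x n
seq-· (+ zero)       x n = sym (ℚ.*-zeroˡ (seq x n))
seq-· (+ suc k)      x n = trans (cong (seq x n ℚ.+_) (seq-· (+ k) x n))
  (trans (solve 2 (λ x k → x :+ k :* x := (con 1ℚ :+ k) :* x) refl (seq x n) (fromℤℚ (+ k)))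
    (cong (ℚ._* seq x n) (sym (fromℤℚ-+ (+ 1) (+ k)))))
seq-· -[1+ zero ]    x n = solve 1 (λ x → :- x := (:- con 1ℚ) :* x) refl (seq x n)
seq-· -[1+ suc k ]   x n = trans (cong (ℚ.- seq x n ℚ.+_) (seq-· -[1+ k ] x n))
  (trans (solve 2 (λ x k → (:- x) :+ k :* x := (:- con 1ℚ :+ k) :* x) refl (seq x n) (fromℤℚ -[1+ k ]))
    (cong (ℚ._* seq x n) (sym (fromℤℚ-+ -[1+ 0 ] -[1+ k ]))))

+-cong : ∀ {x y x′ y′} → x ≈ y → x′ ≈ y′ → x + x′ ≈ y + y′
+-cong {x} {y} {x′} {y′} h h′ = ≲-antisym {x + x′} {y + y′}
  (+-mono-≲ {x} {y} {x′} {y′} (≈⇒≲ {x} {y} h) (≈⇒≲ {x′} {y′} h′))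
  (+-mono-≲ {y} {x} {y′} {x′} (≈⇒≳ {x} {y} h) (≈⇒≳ {x′} {y′} h′))

·-distribʳ-+ : ∀ j k x n → seq ((j ℤ.+ k) · x) n ≡ seq (j · x + k · x) n
·-distribʳ-+ j k x n = trans (seq-· (j ℤ.+ k) x n)
  (trans (cong (ℚ._* seq x n) (fromℤℚ-+ j k))
  (trans (ℚ.*-distribʳ-+ (seq x n) (fromℤℚ j) (fromℤℚ k))
  (sym (cong₂ ℚ._+_ (seq-· j x n) (seq-· k x n)))))

-- A reflective checker for linear consequences: a sequent is accepted when its conclusion is the sum of the
-- hypotheses (each used once) and of copies of 0 < 1, read as linear forms in the variables and 1.

infixl 7 _⊕_ _⊖_
infix  8 ⊝_
infix  6 _:≈_ _:~_ _:≤_ _:<_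
infix  3 _⊢_

data Expr (n : ℕ) : Set where
  var     : Fin n → Expr n
  𝟎 𝟏     : Expr n
  _⊕_ _⊖_ : Expr n → Expr n → Expr n
  ⊝_      : Expr n → Expr n

-- The kind any marks sums to which no relation applies, such as that of a congruence and an inequality.
data Kind : Set where
  equal congruent less-or-equal less any : Kind

record Relation (n : ℕ) : Set where
  constructor rel
  field
    kind    : Kind
    lhs rhs : Expr n

open Relation

pattern _:≈_ x y = rel equal x y
pattern _:~_ x y = rel congruent x y
pattern _:≤_ x y = rel less-or-equal x y
pattern _:<_ x y = rel less x y

record Sequent (n : ℕ) : Set where
  constructor _⊢_
  field
    hypotheses : List (Relation n)
    goal       : Relation n

open Sequent

_⋆_ : Kind → Kind → Kind
equal         ⋆ k             = k
k             ⋆ equal         = k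
congruent     ⋆ congruent     = congruent
less-or-equal ⋆ less-or-equal = less-or-equal
less-or-equal ⋆ less          = less
less          ⋆ less-or-equal = less
less          ⋆ less          = less
_             ⋆ _             = any

_entails_ : Kind → Kind → Bool
equal         entails equal         = true
equal         entails congruent     = true
equal         entails less-or-equal = true
congruent     entails congruent     = true
less-or-equal entails less-or-equal = true
less          entails less-or-equal = true
less          entails less          = true
_             entails _             = false

Form : ℕ → Set
Form n = Vec ℤ (suc n)

normalise : ∀ {n} → Expr n → Form n
normalise (var i) = Vec.replicate _ (+ 0) Vec.[ suc i ]≔ + 1
normalise 𝟎       = Vec.replicate _ (+ 0)
normalise 𝟏       = + 1 ∷ Vec.replicate _ (+ 0)
normalise (x ⊕ y) = Vec.zipWith ℤ._+_ (normalise x) (normalise y)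
normalise (x ⊖ y) = Vec.zipWith ℤ._+_ (normalise x) (Vec.map ℤ.-_ (normalise y))
normalise (⊝ x)   = Vec.map ℤ.-_ (normalise x)

is-zero : ∀ {n} → Vec ℤ n → Bool
is-zero []      = true
is-zero (z ∷ v) = ⌊ z ℤ.≟ + 0 ⌋ ∧ is-zero v

total : ∀ {n} → List (Relation n) → Relation n
total []                = 𝟎 :≈ 𝟎
total (rel k x y ∷ hs) = rel (k ⋆ kind (total hs)) (x ⊕ lhs (total hs)) (y ⊕ rhs (total hs))

-- The leading entry is the coefficient of `𝟏`. A hypothesis `𝟎 :< 𝟏` contributes -1 to it, so a
-- positive leading entry is cancelled by that many copies.
discrepancy : ∀ {n} → Relation n → Relation n → Form n
discrepancy h g = normalise (lhs h ⊖ rhs h ⊖ (lhs g ⊖ rhs g))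

-- The number of copies of 0 < 1 that the hypotheses lack.
slack : ∀ {n} → Sequent n → ℕ
slack (hs ⊢ g) with Vec.head (discrepancy (total hs) g)
... | + c      = c
... | -[1+ _ ] = 0

with-slack : ∀ {n} → Sequent n → List (Relation n)
with-slack (hs ⊢ g) = replicate (slack (hs ⊢ g)) (𝟎 :< 𝟏) ++ hs

follows : ∀ {n} → Sequent n → Bool
follows (hs ⊢ g) = (kind h entails kind g) ∧ is-zero (discrepancy h g)
  where
  h = total (with-slack (hs ⊢ g))

⟪_⟫ : ∀ {n} → Expr n → Vec ℝ n → ℝ
⟪ var i ⟫ ρ = lookup ρ i
⟪ 𝟎     ⟫ ρ = 0ℝ
⟪ 𝟏     ⟫ ρ = 1ℝ
⟪ x ⊕ y ⟫ ρ = ⟪ x ⟫ ρ + ⟪ y ⟫ ρ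
⟪ x ⊖ y ⟫ ρ = ⟪ x ⟫ ρ - ⟪ y ⟫ ρ
⟪ ⊝ x   ⟫ ρ = - ⟪ x ⟫ ρ

module Value (n : ℕ) where

  -- Linear identities are verified term by term: at index `n` a form is a rational combination of
  -- the `n`-th terms of the reals.
  value : ∀ {k} → Vec ℤ k → Vec ℝ k → ℚ
  value []      []      = 0ℚ
  value (z ∷ v) (x ∷ ρ) = fromℤℚ z ℚ.* seq x n ℚ.+ value v ρ

  value-0 : ∀ {k} (ρ : Vec ℝ k) → value (Vec.replicate k (+ 0)) ρ ≡ 0ℚ
  value-0 []      = refl
  value-0 (x ∷ ρ) = cong₂ ℚ._+_ (ℚ.*-zeroˡ (seq x n)) (value-0 ρ)

  value-var : ∀ {k} (i : Fin k) ρ → value (Vec.replicate _ (+ 0) Vec.[ i ]≔ + 1) ρ ≡ seq (lookup ρ i) n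
  value-var zero    (x ∷ ρ) = trans (cong₂ ℚ._+_ (ℚ.*-identityˡ (seq x n)) (value-0 ρ)) (ℚ.+-identityʳ (seq x n))
  value-var (suc i) (x ∷ ρ) = trans (cong₂ ℚ._+_ (ℚ.*-zeroˡ (seq x n)) (value-var i ρ)) (ℚ.+-identityˡ _)

  value-+ : ∀ {k} (v w : Vec ℤ k) ρ → value (Vec.zipWith ℤ._+_ v w) ρ ≡ value v ρ ℚ.+ value w ρ
  value-+ []      []      []      = refl
  value-+ (y ∷ v) (z ∷ w) (x ∷ ρ) = trans
    (cong₂ ℚ._+_ (cong (ℚ._* seq x n) (fromℤℚ-+ y z)) (value-+ v w ρ))
    (solve 5 (λ y z x a b → (y :+ z) :* x :+ (a :+ b) := (y :* x :+ a) :+ (z :* x :+ b)) refl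
      (fromℤℚ y) (fromℤℚ z) (seq x n) (value v ρ) (value w ρ))

  value-neg : ∀ {k} (v : Vec ℤ k) ρ → value (Vec.map ℤ.-_ v) ρ ≡ ℚ.- value v ρ
  value-neg []      []      = refl
  value-neg (z ∷ v) (x ∷ ρ) = trans
    (cong₂ ℚ._+_ (cong (ℚ._* seq x n) (fromℤℚ-neg z)) (value-neg v ρ))
    (solve 3 (λ z x a → (:- z) :* x :+ (:- a) := :- (z :* x :+ a)) refl (fromℤℚ z) (seq x n) (value v ρ))

  value-zero : ∀ {k} (v : Vec ℤ k) ρ → T (is-zero v) → value v ρ ≡ 0ℚ
  value-zero []      []      _ = refl
  value-zero (z ∷ v) (x ∷ ρ) t with z ℤ.≟ + 0
  ... | yes refl = cong₂ ℚ._+_ (ℚ.*-zeroˡ (seq x n)) (value-zero v ρ t)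

  value-normalise : ∀ {k} (e : Expr k) ρ → value (normalise e) (1ℝ ∷ ρ) ≡ seq (⟪ e ⟫ ρ) n
  value-normalise (var i) ρ = value-var (suc i) (1ℝ ∷ ρ)
  value-normalise 𝟎       ρ = value-0 (1ℝ ∷ ρ)
  value-normalise 𝟏       ρ = value-var zero (1ℝ ∷ ρ)
  value-normalise (x ⊕ y) ρ = trans (value-+ (normalise x) (normalise y) (1ℝ ∷ ρ))
    (cong₂ ℚ._+_ (value-normalise x ρ) (value-normalise y ρ))
  value-normalise (x ⊖ y) ρ = trans (value-+ (normalise x) (Vec.map ℤ.-_ (normalise y)) (1ℝ ∷ ρ))
    (cong₂ ℚ._+_ (value-normalise x ρ)
      (trans (value-neg (normalise y) (1ℝ ∷ ρ)) (cong ℚ.-_ (value-normalise y ρ))))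
  value-normalise (⊝ x)   ρ = trans (value-neg (normalise x) (1ℝ ∷ ρ)) (cong ℚ.-_ (value-normalise x ρ))

0<1 : 0ℝ < 1ℝ
0<1 = ½ , ℚ.positive⁻¹ ½ , always λ _ → toWitness {a? = _ ℚ.<? _} tt

module Linear (L : ℝ) where

  Holds : Kind → ℝ → ℝ → Set
  Holds equal         x y = x ≈ y
  Holds congruent     x y = SamePoint L x y
  Holds less-or-equal x y = x ≤ y
  Holds less          x y = x < y
  Holds any           x y = ⊤

  ⟪_⟫ʳ : ∀ {n} → Relation n → Vec ℝ n → Set
  ⟪ rel k x y ⟫ʳ ρ = Holds k (⟪ x ⟫ ρ) (⟪ y ⟫ ρ)

  ⟪_⟫ʰ : ∀ {n} → List (Relation n) → Vec ℝ n → Set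
  ⟪ []     ⟫ʰ ρ = ⊤
  ⟪ h ∷ hs ⟫ʰ ρ = ⟪ h ⟫ʳ ρ × ⟪ hs ⟫ʰ ρ

  ≈⇒~ : ∀ {x y} → x ≈ y → SamePoint L x y
  ≈⇒~ {x} {y} h = + 0 , ≈-resp {x} {y} {x - y} {0ℝ} (λ n → sym (ℚ.+-identityʳ _)) h

  add : ∀ {x y x′ y′} j k → Holds j x y → Holds k x′ y′ → Holds (j ⋆ k) (x + x′) (y + y′)
  add {x} {y} {x′} {y′} = go
    where
    go : ∀ j k → Holds j x y → Holds k x′ y′ → Holds (j ⋆ k) (x + x′) (y + y′)
    le-le : x ≲ y → x′ ≲ y′ → x + x′ ≤ y + y′
    le-le h h′ = ≲⇒≤ {x + x′} {y + y′} (+-mono-≲ {x} {y} {x′} {y′} h h′)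
    lt-le : x < y → x′ ≲ y′ → x + x′ < y + y′
    lt-le = +-mono-<-≲ {x} {y} {x′} {y′}
    le-lt : x ≲ y → x′ < y′ → x + x′ < y + y′
    le-lt h h′ = <-resp {x′ + x} {y′ + y} {x + x′} {y + y′}
      (λ n → cong₂ ℚ._-_ (ℚ.+-comm (seq x′ n) (seq x n)) (ℚ.+-comm (seq y′ n) (seq y n)))
      (+-mono-<-≲ {x′} {y′} {x} {y} h′ h)
    cg-cg : SamePoint L x y → SamePoint L x′ y′ → SamePoint L (x + x′) (y + y′)
    cg-cg (j , h) (k , h′) = j ℤ.+ k , ≈-resp {x - y + (x′ - y′)} {j · L + k · L} {x + x′ - (y + y′)} {(j ℤ.+ k) · L}
      (λ n → cong₂ ℚ._-_
        (solve 4 (λ x y x′ y′ → x :- y :+ (x′ :- y′) := x :+ x′ :- (y :+ y′)) refl (seq x n) (seq y n) (seq x′ n) (seq y′ n))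
        (sym (·-distribʳ-+ j k L n)))
      (+-cong {x - y} {j · L} {x′ - y′} {k · L} h h′)
    go equal         equal         h h′ = +-cong {x} {y} {x′} {y′} h h′
    go equal         congruent     h h′ = cg-cg (≈⇒~ {x} {y} h) h′
    go equal         less-or-equal h h′ = le-le (≈⇒≲ {x} {y} h) (≤⇒≲ {x′} {y′} h′)
    go equal         less          h h′ = le-lt (≈⇒≲ {x} {y} h) h′
    go equal         any           h h′ = tt
    go congruent     equal         h h′ = cg-cg h (≈⇒~ {x′} {y′} h′)
    go congruent     congruent     h h′ = cg-cg h h′
    go congruent     less-or-equal h h′ = tt
    go congruent     less          h h′ = tt
    go congruent     any           h h′ = tt
    go less-or-equal equal         h h′ = le-le (≤⇒≲ {x} {y} h) (≈⇒≲ {x′} {y′} h′)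
    go less-or-equal congruent     h h′ = tt
    go less-or-equal less-or-equal h h′ = le-le (≤⇒≲ {x} {y} h) (≤⇒≲ {x′} {y′} h′)
    go less-or-equal less          h h′ = le-lt (≤⇒≲ {x} {y} h) h′
    go less-or-equal any           h h′ = tt
    go less          equal         h h′ = lt-le h (≈⇒≲ {x′} {y′} h′)
    go less          congruent     h h′ = tt
    go less          less-or-equal h h′ = lt-le h (≤⇒≲ {x′} {y′} h′)
    go less          less          h h′ = +-mono-< {x} {y} {x′} {y′} h h′
    go less          any           h h′ = tt
    go any           equal         h h′ = tt
    go any           congruent     h h′ = tt
    go any           less-or-equal h h′ = tt
    go any           less          h h′ = tt
    go any           any           h h′ = tt

  transport : ∀ k {x y x′ y′} → (x , y) ≐ (x′ , y′) → Holds k x y → Holds k x′ y′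
  transport equal         {x} {y} {x′} {y′} d h       = ≈-resp {x} {y} {x′} {y′} d h
  transport congruent     {x} {y} {x′} {y′} d (k , h) =
    k , ≈-resp {x - y} {k · L} {x′ - y′} {k · L} (λ n → cong (ℚ._- seq (k · L) n) (d n)) h
  transport less-or-equal {x} {y} {x′} {y′} d h       =
    ≲⇒≤ {x′} {y′} (≲-resp {x} {y} {x′} {y′} d (≤⇒≲ {x} {y} h))
  transport less          {x} {y} {x′} {y′} d h       = <-resp {x} {y} {x′} {y′} d h
  transport any           d h = tt

  weaken : ∀ j k {x y} → T (j entails k) → Holds j x y → Holds k x y
  weaken equal         equal         _ h = h
  weaken equal         congruent     {x} {y} _ h = ≈⇒~ {x} {y} h
  weaken equal         less-or-equal {x} {y} _ h = ≲⇒≤ {x} {y} (≈⇒≲ {x} {y} h)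
  weaken congruent     congruent     _ h = h
  weaken less-or-equal less-or-equal _ h = h
  weaken less          less-or-equal {x} {y} _ h = <⇒≤ {x} {y} h
  weaken less          less          _ h = h

  total-holds : ∀ {n} (hs : List (Relation n)) ρ → ⟪ hs ⟫ʰ ρ → ⟪ total hs ⟫ʳ ρ
  total-holds []             ρ _        = ≡⇒≈ {0ℝ} {0ℝ} λ _ → refl
  total-holds (rel k x y ∷ hs) ρ (p , ps) =
    add {⟪ x ⟫ ρ} {⟪ y ⟫ ρ} {⟪ lhs (total hs) ⟫ ρ} {⟪ rhs (total hs) ⟫ ρ} k (kind (total hs)) p (total-holds hs ρ ps)

  slack-holds : ∀ {n} c (hs : List (Relation n)) ρ → ⟪ hs ⟫ʰ ρ → ⟪ replicate c (𝟎 :< 𝟏) ++ hs ⟫ʰ ρ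
  slack-holds zero    hs ρ ps = ps
  slack-holds (suc c) hs ρ ps = 0<1 , slack-holds c hs ρ ps

  follows-sound : ∀ {n} (s : Sequent n) → T (follows s) → ∀ ρ → ⟪ hypotheses s ⟫ʰ ρ → ⟪ goal s ⟫ʳ ρ
  follows-sound (hs ⊢ g) t ρ ps = weaken (kind h) (kind g) {⟪ lhs g ⟫ ρ} {⟪ rhs g ⟫ ρ} (proj₁ split)
    (transport (kind h) {⟪ lhs h ⟫ ρ} {⟪ rhs h ⟫ ρ} {⟪ lhs g ⟫ ρ} {⟪ rhs g ⟫ ρ} same-difference
      (total-holds hs′ ρ (slack-holds (slack (hs ⊢ g)) hs ρ ps)))
    where
    hs′ = with-slack (hs ⊢ g)
    h = total hs′
    split : T (kind h entails kind g) × T (is-zero (discrepancy h g))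
    split = Equivalence.to T-∧ t
    same-difference : (⟪ lhs h ⟫ ρ , ⟪ rhs h ⟫ ρ) ≐ (⟪ lhs g ⟫ ρ , ⟪ rhs g ⟫ ρ)
    same-difference n = p-q≡0⇒p≡q (trans
      (sym (value-normalise (lhs h ⊖ rhs h ⊖ (lhs g ⊖ rhs g)) ρ))
      (value-zero (discrepancy h g) (1ℝ ∷ ρ) (proj₂ split)))
      where
      open Value n
      p-q≡0⇒p≡q : ∀ {p q} → p ℚ.- q ≡ 0ℚ → p ≡ q
      p-q≡0⇒p≡q {p} {q} e = trans (solve 2 (λ p q → p := q :+ (p :- q)) refl p q)
        (trans (cong (q ℚ.+_) e) (ℚ.+-identityʳ q))

  abstract
    -- The sequent is a function of its variables so that it can be written with named binders; the
    -- implicit `T (follows s)` is found by evaluating the checker.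
    lin : ∀ {n} (ρ : Vec ℝ n) (f : N-ary n (Expr n) (Sequent n)) →
          let s = f $ⁿ map var (allFin n) in
          {T (follows s)} → ⟪ hypotheses s ⟫ʰ ρ → ⟪ goal s ⟫ʳ ρ
    lin {n} ρ f {t} = follows-sound (f $ⁿ map var (allFin n)) t ρ

-- Integers among the reals, maxima and the Archimedean property

fromℤℚ-suc : ∀ n → fromℤℚ (+ n) ℚ.+ 1ℚ ≡ fromℤℚ (+ suc n)
fromℤℚ-suc n = trans (ℚ.+-comm (fromℤℚ (+ n)) 1ℚ) (sym (fromℤℚ-+ (+ 1) (+ n)))

fromℤ-suc : ∀ n → fromℤ (+ suc n) ≈ fromℤ (+ n) + 1ℝ
fromℤ-suc n = ≡⇒≈ {fromℤ (+ suc n)} {fromℤ (+ n) + 1ℝ} λ _ → sym (fromℤℚ-suc n)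

fromℤ-+ : ∀ i j → fromℤ (i ℤ.+ j) ≈ fromℤ i + fromℤ j
fromℤ-+ i j = ≡⇒≈ {fromℤ (i ℤ.+ j)} {fromℤ i + fromℤ j} λ _ → fromℤℚ-+ i j

fromℤ-neg : ∀ i → fromℤ (ℤ.- i) ≈ 0ℝ - fromℤ i
fromℤ-neg i = ≡⇒≈ {fromℤ (ℤ.- i)} {0ℝ - fromℤ i} λ _ → trans (fromℤℚ-neg i) (sym (ℚ.+-identityˡ _))

x≤x⊔y : ∀ x y → x ≤ x ⊔ y
x≤x⊔y x y = ≲⇒≤ {x} {x ⊔ y} λ ε ε>0 → always λ n → ℚ.≤-<-trans (ℚ.p≤p⊔q (seq x n) (seq y n)) (p<p+ε _ ε>0)

y≤x⊔y : ∀ x y → y ≤ x ⊔ y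
y≤x⊔y x y = ≲⇒≤ {y} {x ⊔ y} λ ε ε>0 → always λ n → ℚ.≤-<-trans (ℚ.p≤q⊔p (seq x n) (seq y n)) (p<p+ε _ ε>0)

⊔-lub : ∀ {x y z} → x ≤ z → y ≤ z → x ⊔ y ≤ z
⊔-lub {x} {y} {z} x≤z y≤z = ≲⇒≤ {x ⊔ y} {z} λ ε ε>0 → eventually-zip
  (λ n h k → ⊔-lub-< h k) (≤⇒≲ {x} {z} x≤z ε ε>0) (≤⇒≲ {y} {z} y≤z ε ε>0)
  where
  ⊔-lub-< : ∀ {p q r} → p ℚ.< r → q ℚ.< r → p ℚ.⊔ q ℚ.< r
  ⊔-lub-< {p} {q} h k with ℚ.⊔-sel p q
  ... | inj₁ e = subst (ℚ._< _) (sym e) h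
  ... | inj₂ e = subst (ℚ._< _) (sym e) k

-- The denominator is at least 1, so the numerator alone gives an integer bound.
p≤∣↥p∣ : ∀ p → p ℚ.≤ fromℤℚ (+ ℤ.∣ ℚ.↥ p ∣)
p≤∣↥p∣ p@record{} = ℚ.toℚᵘ-cancel-≤ (ℚᵘ.≤-respʳ-≃ (ℚᵘ.≃-sym (ℚ.toℚᵘ-fromℚᵘ (ℚᵘ.mkℚᵘ (+ ℤ.∣ ℚ.↥ p ∣) 0)))
  (ℚᵘ.*≤* (i*1≤∣i∣*d (ℚ.↥ p) (ℚ.denominator-1 p))))
  where
  i*1≤∣i∣*d : ∀ i d → i ℤ.* + 1 ℤ.≤ + ℤ.∣ i ∣ ℤ.* + suc d
  i*1≤∣i∣*d (+ n)    d = subst₂ ℤ._≤_ (ℤ.pos-* n 1) (ℤ.pos-* n (suc d)) (ℤ.+≤+ (ℕ.*-monoʳ-≤ n (ℕ.s≤s ℕ.z≤n)))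
  i*1≤∣i∣*d -[1+ n ] d = ℤ.-≤+

-- From index `N` on, the sequence stays within 1 of its `N`-th term; the second unit above `b` is
-- the uniform margin that `_<_` demands.
archimedean′ : ∀ x → ∃[ n ] (x < fromℤ (+ n))
archimedean′ x =
  let (N , h) = isCauchy x 1ℚ (ℚ.positive⁻¹ 1ℚ)
      b = ℤ.∣ ℚ.↥ seq x N ∣
  in suc (suc b) , 1ℚ , ℚ.positive⁻¹ 1ℚ , N , λ n n≥ → begin-strict
  seq x n ℚ.+ 1ℚ                <⟨ ℚ.+-monoˡ-< 1ℚ (∣p-q∣<ε⇒p<q+ε (seq x n) (seq x N) (h n N n≥ ℕ.≤-refl)) ⟩
  seq x N ℚ.+ 1ℚ ℚ.+ 1ℚ         ≤⟨ ℚ.+-monoˡ-≤ 1ℚ (ℚ.+-monoˡ-≤ 1ℚ (p≤∣↥p∣ (seq x N))) ⟩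
  fromℤℚ (+ b) ℚ.+ 1ℚ ℚ.+ 1ℚ    ≡⟨ cong (ℚ._+ 1ℚ) (fromℤℚ-suc b) ⟩
  fromℤℚ (+ suc b) ℚ.+ 1ℚ       ≡⟨ fromℤℚ-suc (suc b) ⟩
  fromℤℚ (+ suc (suc b))        ∎
  where open ℚ.≤-Reasoning

-- Unfolding the bound would make the type checker unroll every recursion on it.
abstract
  archimedean : ∀ x → ∃[ n ] (x < fromℤ (+ n))
  archimedean = archimedean′

midpoint : ∀ {x y} → x < y → ∃[ δ ] (0ℝ < δ × x + δ + δ ≤ y)
midpoint {x} {y} (ε , ε>0 , x+ε<y) with halve ε>0
... | δ , δ>0 , refl with halve δ>0
-- Positivity of the constant real `δ` needs a rational margin below `δ`; its half `η` provides one.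
... | η , η>0 , refl = fromℚ (η ℚ.+ η) ,
  (η , η>0 , always λ _ → subst (ℚ._< η ℚ.+ η) (sym (ℚ.+-identityˡ η)) (p<p+ε η η>0)) ,
  ≲⇒≤ {x + fromℚ (η ℚ.+ η) + fromℚ (η ℚ.+ η)} {y} λ e e>0 → eventually-map
    (λ n h → ℚ.<-trans (subst (ℚ._< seq y n) (sym (ℚ.+-assoc (seq x n) (η ℚ.+ η) (η ℚ.+ η))) h) (p<p+ε (seq y n) e>0)) x+ε<y

-- Representatives, offsets and distances on the circle

module Circle (em : ExcludedMiddle 0ℓ) (L : ℝ) (3<L : fromℤ (+ 3) < L) where

  open Linear L public

  infix 4 _~_
  _~_ : ℝ → ℝ → Set
  _~_ = SamePoint L

  compare : ∀ x y → x < y ⊎ y ≤ x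
  compare x y with em {P = x < y}
  ... | yes p = inj₁ p
  ... | no  p = inj₂ p

  3<L′ : 1ℝ + 1ℝ + 1ℝ < L
  3<L′ = 3<L

  0<L : 0ℝ < L
  0<L = lin (L ∷ []) (λ L → 𝟏 ⊕ 𝟏 ⊕ 𝟏 :< L ∷ [] ⊢ 𝟎 :< L) (3<L′ , tt)

  1<L : 1ℝ < L
  1<L = lin (L ∷ []) (λ L → 𝟏 ⊕ 𝟏 ⊕ 𝟏 :< L ∷ [] ⊢ 𝟏 :< L) (3<L′ , tt)

  ~-sym : ∀ {x y} → x ~ y → y ~ x
  ~-sym {x} {y} (k , h) = ℤ.- k , ≈-resp {k · L} {x - y} {y - x} {(ℤ.- k) · L}
    (λ n → trans (solve 3 (λ k x y → k :- (x :- y) := y :- x :- (:- k)) refl (seq (k · L) n) (seq x n) (seq y n))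
      (cong (ℚ._-_ (seq y n ℚ.- seq x n)) (trans (cong ℚ.-_ (seq-· k L n))
        (trans (ℚ.neg-distribˡ-* (fromℤℚ k) (seq L n))
        (trans (cong (ℚ._* seq L n) (sym (fromℤℚ-neg k))) (sym (seq-· (ℤ.- k) L n)))))))
    (≈-sym {x - y} {k · L} h)

  L~0 : L ~ 0ℝ
  L~0 = + 1 , ≡⇒≈ {L - 0ℝ} {L + 0ℝ} λ _ → refl

  0~L : 0ℝ ~ L
  0~L = ~-sym {L} {0ℝ} L~0

  ~-refl : ∀ {x} → x ~ x
  ~-refl {x} = lin (x ∷ []) (λ x → [] ⊢ x :~ x) tt

  0≤n·L : ∀ n → 0ℝ ≤ (+ n) · L
  0≤n·L zero    = lin [] ([] ⊢ 𝟎 :≤ 𝟎) tt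
  0≤n·L (suc n) = lin (L ∷ (+ n) · L ∷ []) (λ L nL → 𝟎 :< L ∷ 𝟎 :≤ nL ∷ [] ⊢ 𝟎 :≤ L ⊕ nL) (0<L , 0≤n·L n , tt)

  -n·L≤0 : ∀ n → -[1+ n ] · L ≤ 0ℝ
  -n·L≤0 zero    = lin (L ∷ []) (λ L → 𝟎 :< L ∷ [] ⊢ ⊝ L :≤ 𝟎) (0<L , tt)
  -n·L≤0 (suc n) = lin (L ∷ -[1+ n ] · L ∷ []) (λ L nL → 𝟎 :< L ∷ nL :≤ 𝟎 ∷ [] ⊢ ⊝ L ⊕ nL :≤ 𝟎) (0<L , -n·L≤0 n , tt)

  -- Write `x - y` as `k · L`: a `k` at most 0 contradicts `y < x`, and a `k` at least 2 contradicts
  -- the upper bound.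
  ~-gap : ∀ {x y} → x ~ y → y < x → x < y + L + L → x ≈ y + L
  ~-gap {x} {y} (+ 0 , x-y≈kL) y<x _ = ⊥-elim
    (lin (x ∷ y ∷ []) (λ x y → x ⊖ y :≈ 𝟎 ∷ [] ⊢ x :≤ y) (x-y≈kL , tt) y<x)
  ~-gap {x} {y} (+ 1 , x-y≈kL) _ _ = lin (x ∷ y ∷ L ∷ []) (λ x y L → x ⊖ y :≈ L ⊕ 𝟎 ∷ [] ⊢ x :≈ y ⊕ L) (x-y≈kL , tt)
  ~-gap {x} {y} (+ suc (suc n) , x-y≈kL) _ x<y+2L = ⊥-elim
    (lin (x ∷ y ∷ L ∷ (+ n) · L ∷ []) (λ x y L nL → L ⊕ (L ⊕ nL) :≈ x ⊖ y ∷ 𝟎 :≤ nL ∷ [] ⊢ y ⊕ L ⊕ L :≤ x)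
      (≈-sym {x - y} {(+ suc (suc n)) · L} x-y≈kL , 0≤n·L n , tt) x<y+2L)
  ~-gap {x} {y} (-[1+ n ] , x-y≈kL) y<x _ = ⊥-elim
    (lin (x ∷ y ∷ -[1+ n ] · L ∷ []) (λ x y nL → x ⊖ y :≈ nL ∷ nL :≤ 𝟎 ∷ [] ⊢ x :≤ y)
      (x-y≈kL , -n·L≤0 n , tt) y<x)

  ~-gap-L : ∀ {x y} → x ~ y → y < x → L ≤ x - y
  ~-gap-L {x} {y} x~y y<x x-y<L = lin (x ∷ y ∷ L ∷ []) (λ x y L → y ⊕ L :≈ x ∷ [] ⊢ L :≤ x ⊖ y)
    (≈-sym {x} {y + L} (~-gap {x} {y} x~y y<x
      (lin (x ∷ y ∷ L ∷ []) (λ x y L → x ⊖ y :< L ∷ 𝟎 :< L ∷ [] ⊢ x :< y ⊕ L ⊕ L) (x-y<L , 0<L , tt))) , tt) x-y<L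

  -- The integer bound makes the reduction modulo `L` a structural recursion: since `L > 1`,
  -- subtracting `L` lowers the bound by one.
  represent-nonnegative : ∀ n x → 0ℝ ≤ x → x < fromℤ (+ n) → ∃[ r ] (Represents L r x)
  represent-nonnegative zero    x 0≤x x<0 = ⊥-elim (0≤x x<0)
  represent-nonnegative (suc n) x 0≤x x<1+n with compare x L
  ... | inj₁ x<L = x , 0≤x , x<L , ~-refl {x}
  ... | inj₂ L≤x =
    let (r , 0≤r , r<L , r~x-L) = represent-nonnegative n (x - L)
          (lin (x ∷ L ∷ []) (λ x L → L :≤ x ∷ [] ⊢ 𝟎 :≤ x ⊖ L) (L≤x , tt))
          (lin (x ∷ L ∷ fromℤ (+ n) ∷ fromℤ (+ suc n) ∷ [])
            (λ x L n n′ → x :< n′ ∷ n′ :≈ n ⊕ 𝟏 ∷ 𝟏 :< L ∷ [] ⊢ x ⊖ L :< n)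
            (x<1+n , fromℤ-suc n , 1<L , tt))
    in r , 0≤r , r<L , lin (r ∷ x ∷ L ∷ []) (λ r x L → r :~ x ⊖ L ∷ 𝟎 :~ L ∷ [] ⊢ r :~ x) (r~x-L , 0~L , tt)

  make-nonnegative : ∀ n x → 0ℝ - x < fromℤ (+ n) → ∃[ y ] (0ℝ ≤ y × y ~ x)
  make-nonnegative zero    x -x<0 = x , lin (x ∷ []) (λ x → 𝟎 ⊖ x :< 𝟎 ∷ [] ⊢ 𝟎 :≤ x) (-x<0 , tt) , ~-refl {x}
  make-nonnegative (suc n) x -x<1+n =
    let (y , 0≤y , y~x+L) = make-nonnegative n (x + L)
          (lin (x ∷ L ∷ fromℤ (+ n) ∷ fromℤ (+ suc n) ∷ [])
            (λ x L n n′ → 𝟎 ⊖ x :< n′ ∷ n′ :≈ n ⊕ 𝟏 ∷ 𝟏 :< L ∷ [] ⊢ 𝟎 ⊖ (x ⊕ L) :< n)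
            (-x<1+n , fromℤ-suc n , 1<L , tt))
    in y , 0≤y , lin (y ∷ x ∷ L ∷ []) (λ y x L → y :~ x ⊕ L ∷ L :~ 𝟎 ∷ [] ⊢ y :~ x) (y~x+L , L~0 , tt)

  abstract
    represent : ∀ x → ∃[ r ] (Represents L r x)
    represent x =
      let (n , -x<n) = archimedean (0ℝ - x)
          (y , 0≤y , y~x) = make-nonnegative n x -x<n
          (m , y<m) = archimedean y
          (r , 0≤r , r<L , r~y) = represent-nonnegative m y 0≤y y<m
      in r , 0≤r , r<L , lin (r ∷ y ∷ x ∷ []) (λ r y x → r :~ y ∷ y :~ x ∷ [] ⊢ r :~ x) (r~y , y~x , tt)

  -- Signed offsets replace distances: they add along paths and record direction. With bounds `- ε`
  -- and `ε` this is a ball, with 0 and 1 an oriented arc.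
  record Between (l u x y : ℝ) : Set where
    constructor between
    field
      offset  : ℝ
      lower   : l < offset
      upper   : offset < u
      reaches : y ~ x + offset

  module _ (d : ℝ) where

    private
      m = ∣ d ∣ ⊓ (L - ∣ d ∣)

    ⊓≤∣d∣ : m ≤ ∣ d ∣
    ⊓≤∣d∣ = lin (m ∷ ∣ d ∣ ∷ - ∣ d ∣ ⊔ - (L - ∣ d ∣) ∷ []) (λ m u n → ⊝ u :≤ n ∷ [] ⊢ ⊝ n :≤ u) (x≤x⊔y (- ∣ d ∣) (- (L - ∣ d ∣)) , tt)

    ⊓≤L-∣d∣ : m ≤ L - ∣ d ∣
    ⊓≤L-∣d∣ = lin (L - ∣ d ∣ ∷ - ∣ d ∣ ⊔ - (L - ∣ d ∣) ∷ []) (λ v n → ⊝ v :≤ n ∷ [] ⊢ ⊝ n :≤ v) (y≤x⊔y (- ∣ d ∣) (- (L - ∣ d ∣)) , tt)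

    ⊓-glb : ∀ {w} → w ≤ ∣ d ∣ → w ≤ L - ∣ d ∣ → w ≤ m
    ⊓-glb {w} w≤∣d∣ w≤L-∣d∣ = lin (w ∷ - ∣ d ∣ ⊔ - (L - ∣ d ∣) ∷ []) (λ w n → n :≤ ⊝ w ∷ [] ⊢ w :≤ ⊝ n)
      (⊔-lub { - ∣ d ∣} { - (L - ∣ d ∣)} { - w}
        (lin (w ∷ ∣ d ∣ ∷ []) (λ w u → w :≤ u ∷ [] ⊢ ⊝ u :≤ ⊝ w) (w≤∣d∣ , tt))
        (lin (w ∷ L - ∣ d ∣ ∷ []) (λ w u → w :≤ u ∷ [] ⊢ ⊝ u :≤ ⊝ w) (w≤L-∣d∣ , tt)) , tt)

    d≤∣d∣ : d ≤ ∣ d ∣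
    d≤∣d∣ = x≤x⊔y d (- d)

    -d≤∣d∣ : - d ≤ ∣ d ∣
    -d≤∣d∣ = y≤x⊔y d (- d)

  ∣∣-≤ : ∀ {d u} → d ≤ u → - d ≤ u → ∣ d ∣ ≤ u
  ∣∣-≤ {d} {u} = ⊔-lub {d} { - d} {u}

  dist⇒between : ∀ {ε a b r} → 0ℝ < ε → Dist L a b r → r < ε → Between (- ε) ε a b
  dist⇒between {ε} {a} {b} {r} 0<ε (x , y , (0≤x , x<L , x~a) , (0≤y , y<L , y~b) , r≈m) r<ε =
    case compare ∣ x - y ∣ ε of λ where
      (inj₁ D<ε) → between (y - x)
            (lin (x ∷ y ∷ ∣ x - y ∣ ∷ ε ∷ []) (λ x y D ε → x ⊖ y :≤ D ∷ D :< ε ∷ [] ⊢ ⊝ ε :< y ⊖ x) (d≤∣d∣ (x - y) , D<ε , tt))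
            (lin (x ∷ y ∷ ∣ x - y ∣ ∷ ε ∷ []) (λ x y D ε → ⊝ (x ⊖ y) :≤ D ∷ D :< ε ∷ [] ⊢ y ⊖ x :< ε) (-d≤∣d∣ (x - y) , D<ε , tt))
            (lin (x ∷ y ∷ a ∷ b ∷ []) (λ x y a b → x :~ a ∷ b :~ y ∷ [] ⊢ b :~ a ⊕ (y ⊖ x)) (x~a , ~-sym {y} {b} y~b , tt))
      (inj₂ ε≤D) → case compare (L - ∣ x - y ∣) ε of λ where
        (inj₂ ε≤L-D) → ⊥-elim (lin (ε ∷ r ∷ ∣ x - y ∣ ⊓ (L - ∣ x - y ∣) ∷ []) (λ ε r m → ε :≤ m ∷ m :≈ r ∷ [] ⊢ ε :≤ r)
            (⊓-glb (x - y) {ε} ε≤D ε≤L-D , ≈-sym {r} {∣ x - y ∣ ⊓ (L - ∣ x - y ∣)} r≈m , tt) r<ε)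
        -- The arc shorter than `ε` passes through the point 0, so `y - x` has to be corrected by
        -- `L`, with a sign depending on which representative is larger.
        (inj₁ L-D<ε) → case compare x y of λ where
          (inj₁ x<y) → between (y - x - L)
            (lin (x ∷ y ∷ L ∷ ∣ x - y ∣ ∷ ε ∷ []) (λ x y L D ε → D :≤ y ⊖ x ∷ L ⊖ D :< ε ∷ [] ⊢ ⊝ ε :< y ⊖ x ⊖ L)
              (∣∣-≤ {x - y} {y - x}
                -- On one side the goal reads 2x against 2y, so `x < y` is supplied twice.
                (lin (x ∷ y ∷ []) (λ x y → x :< y ∷ x :< y ∷ [] ⊢ x ⊖ y :≤ y ⊖ x) (x<y , x<y , tt))
                (lin (x ∷ y ∷ []) (λ x y → [] ⊢ ⊝ (x ⊖ y) :≤ y ⊖ x) tt) , L-D<ε , tt))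
            (lin (x ∷ y ∷ L ∷ ε ∷ []) (λ x y L ε → y :< L ∷ 𝟎 :≤ x ∷ 𝟎 :< ε ∷ [] ⊢ y ⊖ x ⊖ L :< ε) (y<L , 0≤x , 0<ε , tt))
            (lin (x ∷ y ∷ L ∷ a ∷ b ∷ []) (λ x y L a b → x :~ a ∷ b :~ y ∷ L :~ 𝟎 ∷ [] ⊢ b :~ a ⊕ (y ⊖ x ⊖ L))
              (x~a , ~-sym {y} {b} y~b , L~0 , tt))
          (inj₂ y≤x) → between (L - (x - y))
            (lin (x ∷ y ∷ L ∷ ε ∷ []) (λ x y L ε → x :< L ∷ 𝟎 :≤ y ∷ 𝟎 :< ε ∷ [] ⊢ ⊝ ε :< L ⊖ (x ⊖ y)) (x<L , 0≤y , 0<ε , tt))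
            (lin (x ∷ y ∷ L ∷ ∣ x - y ∣ ∷ ε ∷ []) (λ x y L D ε → D :≤ x ⊖ y ∷ L ⊖ D :< ε ∷ [] ⊢ L ⊖ (x ⊖ y) :< ε)
              (∣∣-≤ {x - y} {x - y}
                (lin (x ∷ y ∷ []) (λ x y → [] ⊢ x ⊖ y :≤ x ⊖ y) tt)
                (lin (x ∷ y ∷ []) (λ x y → y :≤ x ∷ y :≤ x ∷ [] ⊢ ⊝ (x ⊖ y) :≤ x ⊖ y) (y≤x , y≤x , tt)) , L-D<ε , tt))
            (lin (x ∷ y ∷ L ∷ a ∷ b ∷ []) (λ x y L a b → x :~ a ∷ b :~ y ∷ 𝟎 :~ L ∷ [] ⊢ b :~ a ⊕ (L ⊖ (x ⊖ y)))
              (x~a , ~-sym {y} {b} y~b , 0~L , tt))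

  represents : ∀ {r x} → 0ℝ ≤ r → r < L → r ~ x → Represents L r x
  represents p q r = p , q , r

  near-intro : ∀ {a b x y} → Represents L x a → Represents L y b →
               ∣ x - y ∣ < 1ℝ ⊎ L - ∣ x - y ∣ < 1ℝ → Near L a b
  near-intro {a} {b} {x} {y} x∈a y∈b close = m , (x , y , x∈a , y∈b , ≡⇒≈ {m} {m} λ _ → refl) , m<1 close
    where
    m = ∣ x - y ∣ ⊓ (L - ∣ x - y ∣)
    m<1 : ∣ x - y ∣ < 1ℝ ⊎ L - ∣ x - y ∣ < 1ℝ → m < 1ℝ
    m<1 (inj₁ D<1) = lin (m ∷ ∣ x - y ∣ ∷ []) (λ m D → m :≤ D ∷ D :< 𝟏 ∷ [] ⊢ m :< 𝟏) (⊓≤∣d∣ (x - y) , D<1 , tt)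
    m<1 (inj₂ D<1) = lin (m ∷ L - ∣ x - y ∣ ∷ []) (λ m D → m :≤ D ∷ D :< 𝟏 ∷ [] ⊢ m :< 𝟏) (⊓≤L-∣d∣ (x - y) , D<1 , tt)

  -- The representative of `b` is `x + s`, moved once by `L` if it has left [0, L). After such a
  -- move the offset `s` measures the complementary arc, whence the second alternative of
  -- `near-intro`.
  between⇒near : ∀ {a b} → Between (- 1ℝ) 1ℝ a b → Near L a b
  between⇒near {a} {b} (between s -1<s s<1 b~a+s) =
    let (x , x∈a@(0≤x , x<L , x~a)) = represent a in
    case compare s 0ℝ of λ where
      (inj₁ s<0) → case compare (x + s) 0ℝ of λ where
        (inj₁ x+s<0) →
          near-intro {a} {b} {x} {x + s + L} x∈a
            (represents {x + s + L} {b}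
              (lin (x ∷ s ∷ L ∷ []) (λ x s L → 𝟎 :≤ x ∷ ⊝ 𝟏 :< s ∷ 𝟏 :< L ∷ [] ⊢ 𝟎 :≤ x ⊕ s ⊕ L) (0≤x , -1<s , 1<L , tt))
              (lin (x ∷ s ∷ L ∷ []) (λ x s L → x ⊕ s :< 𝟎 ∷ [] ⊢ x ⊕ s ⊕ L :< L) (x+s<0 , tt))
              (lin (x ∷ s ∷ L ∷ a ∷ b ∷ []) (λ x s L a b → x :~ a ∷ a ⊕ s :~ b ∷ L :~ 𝟎 ∷ [] ⊢ x ⊕ s ⊕ L :~ b)
                (x~a , ~-sym {b} {a + s} b~a+s , L~0 , tt)))
            (inj₂ (lin (x ∷ s ∷ L ∷ ∣ x - (x + s + L) ∣ ∷ []) (λ x s L D → ⊝ (x ⊖ (x ⊕ s ⊕ L)) :≤ D ∷ ⊝ 𝟏 :< s ∷ [] ⊢ L ⊖ D :< 𝟏)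
              (-d≤∣d∣ (x - (x + s + L)) , -1<s , tt)))
        (inj₂ 0≤x+s) →
          near-intro {a} {b} {x} {x + s} x∈a
            (represents {x + s} {b} 0≤x+s
              (lin (x ∷ s ∷ L ∷ []) (λ x s L → x :< L ∷ s :< 𝟎 ∷ [] ⊢ x ⊕ s :< L) (x<L , s<0 , tt))
              (lin (x ∷ s ∷ a ∷ b ∷ []) (λ x s a b → x :~ a ∷ a ⊕ s :~ b ∷ [] ⊢ x ⊕ s :~ b)
                (x~a , ~-sym {b} {a + s} b~a+s , tt)))
            (inj₁ (lin (∣ x - (x + s) ∣ ∷ s ∷ []) (λ D s → D :≤ ⊝ s ∷ ⊝ 𝟏 :< s ∷ [] ⊢ D :< 𝟏)
              (∣∣-≤ {x - (x + s)} { - s}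
                (lin (x ∷ s ∷ []) (λ x s → [] ⊢ x ⊖ (x ⊕ s) :≤ ⊝ s) tt)
                (lin (x ∷ s ∷ []) (λ x s → s :< 𝟎 ∷ s :< 𝟎 ∷ [] ⊢ ⊝ (x ⊖ (x ⊕ s)) :≤ ⊝ s) (s<0 , s<0 , tt)) , -1<s , tt)))
      (inj₂ 0≤s) → case compare (x + s) L of λ where
        (inj₁ x+s<L) →
          near-intro {a} {b} {x} {x + s} x∈a
            (represents {x + s} {b}
              (lin (x ∷ s ∷ []) (λ x s → 𝟎 :≤ x ∷ 𝟎 :≤ s ∷ [] ⊢ 𝟎 :≤ x ⊕ s) (0≤x , 0≤s , tt))
              x+s<L
              (lin (x ∷ s ∷ a ∷ b ∷ []) (λ x s a b → x :~ a ∷ a ⊕ s :~ b ∷ [] ⊢ x ⊕ s :~ b)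
                (x~a , ~-sym {b} {a + s} b~a+s , tt)))
            (inj₁ (lin (∣ x - (x + s) ∣ ∷ s ∷ []) (λ D s → D :≤ s ∷ s :< 𝟏 ∷ [] ⊢ D :< 𝟏)
              (∣∣-≤ {x - (x + s)} {s}
                (lin (x ∷ s ∷ []) (λ x s → 𝟎 :≤ s ∷ 𝟎 :≤ s ∷ [] ⊢ x ⊖ (x ⊕ s) :≤ s) (0≤s , 0≤s , tt))
                (lin (x ∷ s ∷ []) (λ x s → [] ⊢ ⊝ (x ⊖ (x ⊕ s)) :≤ s) tt) , s<1 , tt)))
        (inj₂ L≤x+s) →
          near-intro {a} {b} {x} {x + s - L} x∈a
            (represents {x + s - L} {b}
              (lin (x ∷ s ∷ L ∷ []) (λ x s L → L :≤ x ⊕ s ∷ [] ⊢ 𝟎 :≤ x ⊕ s ⊖ L) (L≤x+s , tt))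
              (lin (x ∷ s ∷ L ∷ []) (λ x s L → x :< L ∷ s :< 𝟏 ∷ 𝟏 :< L ∷ [] ⊢ x ⊕ s ⊖ L :< L) (x<L , s<1 , 1<L , tt))
              (lin (x ∷ s ∷ L ∷ a ∷ b ∷ []) (λ x s L a b → x :~ a ∷ a ⊕ s :~ b ∷ 𝟎 :~ L ∷ [] ⊢ x ⊕ s ⊖ L :~ b)
                (x~a , ~-sym {b} {a + s} b~a+s , 0~L , tt)))
            (inj₂ (lin (x ∷ s ∷ L ∷ ∣ x - (x + s - L) ∣ ∷ []) (λ x s L D → x ⊖ (x ⊕ s ⊖ L) :≤ D ∷ s :< 𝟏 ∷ [] ⊢ L ⊖ D :< 𝟏)
              (d≤∣d∣ (x - (x + s - L)) , s<1 , tt)))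

  near⇒between : ∀ {a b} → Near L a b → Between (- 1ℝ) 1ℝ a b
  near⇒between {a} {b} (r , d , r<1) = dist⇒between {1ℝ} {a} {b} {r} 0<1 d r<1

  -- Nearness would give an offset `t` in (-1, 1) congruent to `s`, but then 0 < s - t < 3 < L.
  ¬near : ∀ {a b} s → 1ℝ ≤ s → s < 1ℝ + 1ℝ → b ~ a + s → ¬ Near L a b
  ¬near {a} {b} s 1≤s s<2 b~a+s near =
    let (between t -1<t t<1 b~a+t) = near⇒between {a} {b} near in
    ~-gap-L {s} {t}
      (lin (a ∷ b ∷ s ∷ t ∷ []) (λ a b s t → a ⊕ s :~ b ∷ b :~ a ⊕ t ∷ [] ⊢ s :~ t) (~-sym {b} {a + s} b~a+s , b~a+t , tt))
      (lin (s ∷ t ∷ []) (λ s t → 𝟏 :≤ s ∷ t :< 𝟏 ∷ [] ⊢ t :< s) (1≤s , t<1 , tt))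
      (lin (s ∷ t ∷ L ∷ []) (λ s t L → s :< 𝟏 ⊕ 𝟏 ∷ ⊝ 𝟏 :< t ∷ 𝟏 ⊕ 𝟏 ⊕ 𝟏 :< L ∷ [] ⊢ s ⊖ t :< L) (s<2 , -1<t , 3<L′ , tt))

-- The circular order

module Oriented (em : ExcludedMiddle 0ℓ) (L : ℝ) (3<L : fromℤ (+ 3) < L) where
  open Circle em L 3<L public

  -- The order `C` without representatives: the positive way from `a` through `b` and `c` back to
  -- `a` makes exactly one turn. Distinct points in the opposite order need two turns. This form is
  -- symmetric under rotation and does not depend on where the circle is cut.
  record Cycle (a b c : ℝ) : Set where
    constructor cycle
    field
      s₁ s₂ s₃ : ℝ
      0<s₁     : 0ℝ < s₁
      0<s₂     : 0ℝ < s₂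
      0<s₃     : 0ℝ < s₃
      reaches₁ : b ~ a + s₁
      reaches₂ : c ~ b + s₂
      reaches₃ : a ~ c + s₃
      once     : s₁ + s₂ + s₃ ≈ L

  rotate : ∀ {a b c} → Cycle a b c → Cycle b c a
  rotate (cycle s₁ s₂ s₃ p₁ p₂ p₃ r₁ r₂ r₃ once) = cycle s₂ s₃ s₁ p₂ p₃ p₁ r₂ r₃ r₁
    (lin (s₁ ∷ s₂ ∷ s₃ ∷ L ∷ []) (λ s₁ s₂ s₃ L → s₁ ⊕ s₂ ⊕ s₃ :≈ L ∷ [] ⊢ s₂ ⊕ s₃ ⊕ s₁ :≈ L) (once , tt))

  increasing⇒cycle : ∀ {a b c x y z} → Represents L x a → Represents L y b → Represents L z c →
                     x < y → y < z → Cycle a b c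
  increasing⇒cycle {a} {b} {c} {x} {y} {z} (0≤x , _ , x~a) (_ , _ , y~b) (_ , z<L , z~c) x<y y<z =
    cycle (y - x) (z - y) (L - (z - x))
      (lin (x ∷ y ∷ []) (λ x y → x :< y ∷ [] ⊢ 𝟎 :< y ⊖ x) (x<y , tt))
      (lin (y ∷ z ∷ []) (λ x y → x :< y ∷ [] ⊢ 𝟎 :< y ⊖ x) (y<z , tt))
      (lin (x ∷ z ∷ L ∷ []) (λ x z L → 𝟎 :≤ x ∷ z :< L ∷ [] ⊢ 𝟎 :< L ⊖ (z ⊖ x)) (0≤x , z<L , tt))
      (lin (x ∷ y ∷ a ∷ b ∷ []) (λ x y a b → x :~ a ∷ b :~ y ∷ [] ⊢ b :~ a ⊕ (y ⊖ x)) (x~a , ~-sym {y} {b} y~b , tt))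
      (lin (y ∷ z ∷ b ∷ c ∷ []) (λ x y a b → x :~ a ∷ b :~ y ∷ [] ⊢ b :~ a ⊕ (y ⊖ x)) (y~b , ~-sym {z} {c} z~c , tt))
      (lin (x ∷ z ∷ a ∷ c ∷ L ∷ []) (λ x z a c L → z :~ c ∷ a :~ x ∷ 𝟎 :~ L ∷ [] ⊢ a :~ c ⊕ (L ⊖ (z ⊖ x)))
        (z~c , ~-sym {x} {a} x~a , 0~L , tt))
      (lin (x ∷ y ∷ z ∷ L ∷ []) (λ x y z L → [] ⊢ y ⊖ x ⊕ (z ⊖ y) ⊕ (L ⊖ (z ⊖ x)) :≈ L) tt)

  C⇒cycle : ∀ {a b c} → C L a b c → Cycle a b c
  C⇒cycle {a} {b} {c} (x , y , z , x∈a , y∈b , z∈c , order) = case order of λ where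
    (inj₁ (x<y , y<z))        → increasing⇒cycle {a} {b} {c} {x} {y} {z} x∈a y∈b z∈c x<y y<z
    (inj₂ (inj₁ (y<z , z<x))) → rotate (rotate (increasing⇒cycle {b} {c} {a} {y} {z} {x} y∈b z∈c x∈a y<z z<x))
    (inj₂ (inj₂ (z<x , x<y))) → rotate (increasing⇒cycle {c} {a} {b} {z} {x} {y} z∈c x∈a y∈b z<x x<y)

  C-intro : ∀ {a b c x y z} → Represents L x a → Represents L y b → Represents L z c →
            (x < y × y < z) ⊎ (y < z × z < x) ⊎ (z < x × x < y) → C L a b c
  C-intro {a} {b} {c} {x} {y} {z} x∈a y∈b z∈c order = x , y , z , x∈a , y∈b , z∈c , order

  -- The lifts `y` and `z` follow `x` and stay below `x + L`. Whether neither, only `z`, or both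
  -- have passed `L` decides which of the three orders the representatives are in.
  cycle⇒C-from : ∀ {a b c x} → Represents L x a → Cycle a b c → C L a b c
  cycle⇒C-from {a} {b} {c} {x} x∈a@(0≤x , x<L , x~a) (cycle s₁ s₂ s₃ 0<s₁ 0<s₂ 0<s₃ b~a+s₁ c~b+s₂ _ once) =
    case compare z L of λ where
      (inj₁ z<L) → C-intro {a} {b} {c} {x} {y} {z} x∈a
        (represents {y} {b} 0≤y (lin (y ∷ z ∷ L ∷ []) (λ w x L → w :< x ∷ x :< L ∷ [] ⊢ w :< L) (y<z , z<L , tt)) y~b)
        (represents {z} {c} 0≤z z<L z~c) (inj₁ (x<y , y<z))
      (inj₂ L≤z) → case compare y L of λ where
        (inj₁ y<L) → C-intro {a} {b} {c} {x} {y} {z - L} x∈a (represents {y} {b} 0≤y y<L y~b)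
          (represents {z - L} {c} (wrap-0≤ z L≤z) (below (z - L) z-L<x) (wrap-~ z c z~c))
          (inj₂ (inj₂ (z-L<x , x<y)))
        (inj₂ L≤y) → C-intro {a} {b} {c} {x} {y - L} {z - L} x∈a
          (represents {y - L} {b} (wrap-0≤ y L≤y)
            (lin (y - L ∷ z - L ∷ L ∷ []) (λ w x L → w :< x ∷ x :< L ∷ [] ⊢ w :< L) (y-L<z-L , below (z - L) z-L<x , tt))
            (wrap-~ y b y~b))
          (represents {z - L} {c} (wrap-0≤ z L≤z) (below (z - L) z-L<x) (wrap-~ z c z~c))
          (inj₂ (inj₁ (y-L<z-L , z-L<x)))
    where
    s₁+s₂<L : s₁ + s₂ < L
    s₁+s₂<L = lin (s₁ ∷ s₂ ∷ s₃ ∷ L ∷ []) (λ s₁ s₂ s₃ L → s₁ ⊕ s₂ ⊕ s₃ :≈ L ∷ 𝟎 :< s₃ ∷ [] ⊢ s₁ ⊕ s₂ :< L)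
      (once , 0<s₃ , tt)
    y = x + s₁
    z = x + s₁ + s₂
    y~b : y ~ b
    y~b = lin (x ∷ s₁ ∷ a ∷ b ∷ []) (λ x s a b → x :~ a ∷ a ⊕ s :~ b ∷ [] ⊢ x ⊕ s :~ b)
      (x~a , ~-sym {b} {a + s₁} b~a+s₁ , tt)
    z~c : z ~ c
    z~c = lin (y ∷ s₂ ∷ b ∷ c ∷ []) (λ x s a b → x :~ a ∷ a ⊕ s :~ b ∷ [] ⊢ x ⊕ s :~ b)
      (y~b , ~-sym {c} {b + s₂} c~b+s₂ , tt)
    0≤y : 0ℝ ≤ y
    0≤y = lin (x ∷ s₁ ∷ []) (λ x s → 𝟎 :≤ x ∷ 𝟎 :< s ∷ [] ⊢ 𝟎 :≤ x ⊕ s) (0≤x , 0<s₁ , tt)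
    0≤z : 0ℝ ≤ z
    0≤z = lin (y ∷ s₂ ∷ []) (λ x s → 𝟎 :≤ x ∷ 𝟎 :< s ∷ [] ⊢ 𝟎 :≤ x ⊕ s) (0≤y , 0<s₂ , tt)
    x<y : x < y
    x<y = lin (x ∷ s₁ ∷ []) (λ x s → 𝟎 :< s ∷ [] ⊢ x :< x ⊕ s) (0<s₁ , tt)
    y<z : y < z
    y<z = lin (y ∷ s₂ ∷ []) (λ x s → 𝟎 :< s ∷ [] ⊢ x :< x ⊕ s) (0<s₂ , tt)
    z-L<x : z - L < x
    z-L<x = lin (x ∷ s₁ ∷ s₂ ∷ L ∷ []) (λ x s₁ s₂ L → s₁ ⊕ s₂ :< L ∷ [] ⊢ x ⊕ s₁ ⊕ s₂ ⊖ L :< x) (s₁+s₂<L , tt)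
    wrap-~ : ∀ w v → w ~ v → w - L ~ v
    wrap-~ w v w~v = lin (w ∷ v ∷ L ∷ []) (λ w v L → w :~ v ∷ 𝟎 :~ L ∷ [] ⊢ w ⊖ L :~ v) (w~v , 0~L , tt)
    wrap-0≤ : ∀ w → L ≤ w → 0ℝ ≤ w - L
    wrap-0≤ w L≤w = lin (w ∷ L ∷ []) (λ w L → L :≤ w ∷ [] ⊢ 𝟎 :≤ w ⊖ L) (L≤w , tt)
    below : ∀ w → w < x → w < L
    below w w<x = lin (w ∷ x ∷ L ∷ []) (λ w x L → w :< x ∷ x :< L ∷ [] ⊢ w :< L) (w<x , x<L , tt)
    y-L<z-L : y - L < z - L
    y-L<z-L = lin (y ∷ z ∷ L ∷ []) (λ y z L → y :< z ∷ [] ⊢ y ⊖ L :< z ⊖ L) (y<z , tt)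

  cycle⇒C : ∀ {a b c} → Cycle a b c → C L a b c
  cycle⇒C {a} {b} {c} = cycle⇒C-from {a} {b} {c} {proj₁ (represent a)} (proj₂ (represent a))

  once-around : ∀ {a b c s₁ s₂ s₃} → 0ℝ < s₁ + s₂ + s₃ → s₁ + s₂ + s₃ < L + L →
                b ~ a + s₁ → c ~ b + s₂ → a ~ c + s₃ → s₁ + s₂ + s₃ ≈ L
  once-around {a} {b} {c} {s₁} {s₂} {s₃} 0<s s<2L b~a+s₁ c~b+s₂ a~c+s₃ =
    lin (s ∷ L ∷ []) (λ s L → s :≈ 𝟎 ⊕ L ∷ [] ⊢ s :≈ L)
      (~-gap {s} {0ℝ}
        (~-sym {0ℝ} {s} (lin (a ∷ b ∷ c ∷ s₁ ∷ s₂ ∷ s₃ ∷ [])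
          (λ a b c s₁ s₂ s₃ → b :~ a ⊕ s₁ ∷ c :~ b ⊕ s₂ ∷ a :~ c ⊕ s₃ ∷ [] ⊢ 𝟎 :~ s₁ ⊕ s₂ ⊕ s₃)
          (b~a+s₁ , c~b+s₂ , a~c+s₃ , tt)))
        0<s (lin (s ∷ L ∷ []) (λ s L → s :< L ⊕ L ∷ [] ⊢ s :< 𝟎 ⊕ L ⊕ L) (s<2L , tt)) , tt)
    where
    s = s₁ + s₂ + s₃

-- Open arcs of length 1

module Arcs (em : ExcludedMiddle 0ℓ) (L : ℝ) (3<L : fromℤ (+ 3) < L)
            (S : Pred ℝ 0ℓ) (dense : Dense L S) where
  open Oriented em L 3<L public

  Point : Set
  Point = Σ ℝ S

  Arc : ℝ → ℝ → Set
  Arc = Between 0ℝ 1ℝ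

  -- Density is applied to the ball of radius `δ` about `x + (l + δ)`, which covers the offsets from
  -- `l` to `l + δ + δ`.
  dense-between : ∀ x {l u} → l < u → ∃[ w ] (Between l u x (proj₁ {B = S} w))
  dense-between x {l} {u} l<u =
    let (δ , 0<δ , l+2δ≤u) = midpoint {l} {u} l<u
        (w , w∈S , r , d , r<δ) = dense (x + (l + δ)) δ 0<δ
        (between t -δ<t t<δ w~) = dist⇒between {δ} {x + (l + δ)} {w} {r} 0<δ d r<δ
    in (w , w∈S) , between (l + δ + t)
      (lin (l ∷ δ ∷ t ∷ []) (λ l δ t → ⊝ δ :< t ∷ [] ⊢ l :< l ⊕ δ ⊕ t) (-δ<t , tt))
      (lin (l ∷ δ ∷ t ∷ u ∷ []) (λ l δ t u → t :< δ ∷ l ⊕ δ ⊕ δ :≤ u ∷ [] ⊢ l ⊕ δ ⊕ t :< u) (t<δ , l+2δ≤u , tt))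
      (lin (w ∷ x ∷ l ∷ δ ∷ t ∷ []) (λ w x l δ t → w :~ x ⊕ (l ⊕ δ) ⊕ t ∷ [] ⊢ w :~ x ⊕ (l ⊕ δ ⊕ t)) (w~ , tt))

  arc⇒near : ∀ {x y} → Arc x y → Near L x y
  arc⇒near {x} {y} (between s 0<s s<1 y~) = between⇒near {x} {y} (between s
    (lin (s ∷ []) (λ s → 𝟎 :< s ∷ [] ⊢ ⊝ 𝟏 :< s) (0<s , tt)) s<1 y~)

  infixr 9 _⨾_
  -- The intermediate point lies in `S`, as the value of a quantifier does; the outer points may be
  -- any reals.
  _⨾_ : Rel ℝ 0ℓ → Rel ℝ 0ℓ → Rel ℝ 0ℓ
  (R ⨾ Q) x y = ∃[ z ] (R x (proj₁ {B = S} z) × Q (proj₁ z) y)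

  infix 4 _≁_
  _≁_ : Rel ℝ 0ℓ
  x ≁ y = ¬ Near L x y

  ShiftedArc : ℝ → Rel ℝ 0ℓ
  ShiftedArc α x y = Arc (x + α) y

  NextArc : ℝ → Rel ℝ 0ℓ
  NextArc α x b = (ShiftedArc α ⨾ Arc) x b × (ShiftedArc α ⨾ _≁_) x b

  -- With `b` at `u + 1 + s`, a `d` beyond `u + s` is less than 1 behind `b`, while an `e` before
  -- `u + s` is more than 1 behind it.
  arc-suc⇒ : ∀ {α x b} → Arc (x + α + 1ℝ) b → NextArc α x b
  arc-suc⇒ {α} {x} {b} (between s 0<s s<1 b~u+1+s) =
    let u = x + α
        (d , between δ s<δ δ<1 d~) = dense-between u {s} {1ℝ} s<1
        (e , between ε 0<ε ε<s e~) = dense-between u {0ℝ} {s} 0<s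
    in
      (d ,
      between δ (lin (s ∷ δ ∷ []) (λ s δ → 𝟎 :< s ∷ s :< δ ∷ [] ⊢ 𝟎 :< δ) (0<s , s<δ , tt)) δ<1 d~ ,
      between (1ℝ + s - δ)
        (lin (s ∷ δ ∷ []) (λ s δ → 𝟎 :< s ∷ δ :< 𝟏 ∷ [] ⊢ 𝟎 :< 𝟏 ⊕ s ⊖ δ) (0<s , δ<1 , tt))
        (lin (s ∷ δ ∷ []) (λ s δ → s :< δ ∷ [] ⊢ 𝟏 ⊕ s ⊖ δ :< 𝟏) (s<δ , tt))
        (lin (b ∷ u ∷ s ∷ δ ∷ proj₁ d ∷ []) (λ b u s δ d → b :~ u ⊕ 𝟏 ⊕ s ∷ u ⊕ δ :~ d ∷ [] ⊢ b :~ d ⊕ (𝟏 ⊕ s ⊖ δ))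
          (b~u+1+s , ~-sym {proj₁ d} {u + δ} d~ , tt))) ,
      (e ,
      between ε 0<ε (lin (ε ∷ s ∷ []) (λ ε s → ε :< s ∷ s :< 𝟏 ∷ [] ⊢ ε :< 𝟏) (ε<s , s<1 , tt)) e~ ,
      ¬near {proj₁ e} {b} (1ℝ + s - ε)
        (lin (s ∷ ε ∷ []) (λ s ε → ε :< s ∷ [] ⊢ 𝟏 :≤ 𝟏 ⊕ s ⊖ ε) (ε<s , tt))
        (lin (s ∷ ε ∷ []) (λ s ε → 𝟎 :< ε ∷ s :< 𝟏 ∷ [] ⊢ 𝟏 ⊕ s ⊖ ε :< 𝟏 ⊕ 𝟏) (0<ε , s<1 , tt))
        (lin (b ∷ u ∷ s ∷ ε ∷ proj₁ e ∷ []) (λ b u s ε e → b :~ u ⊕ 𝟏 ⊕ s ∷ u ⊕ ε :~ e ∷ [] ⊢ b :~ e ⊕ (𝟏 ⊕ s ⊖ ε))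
          (b~u+1+s , ~-sym {proj₁ e} {u + ε} e~ , tt)))

  -- The point `d` places `b` at offset `δ + β` below 2 from `u`. Since `e` is not near `b`, this
  -- offset exceeds `ε` by at least 1, so it is greater than 1.
  arc-suc⇐ : ∀ {α x b} → NextArc α x b → Arc (x + α + 1ℝ) b
  arc-suc⇐ {α} {x} {b} (((d , _) , between δ 0<δ δ<1 d~ , between β 0<β β<1 b~) , (e , _) , between ε 0<ε ε<1 e~ , e≁b) =
    between (δ + β - 1ℝ)
      (lin (δ ∷ β ∷ ε ∷ []) (λ δ β ε → 𝟎 :< ε ∷ 𝟏 :≤ δ ⊕ β ⊖ ε ∷ [] ⊢ 𝟎 :< δ ⊕ β ⊖ 𝟏) (0<ε , far , tt))
      (lin (δ ∷ β ∷ []) (λ δ β → δ :< 𝟏 ∷ β :< 𝟏 ∷ [] ⊢ δ ⊕ β ⊖ 𝟏 :< 𝟏) (δ<1 , β<1 , tt))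
      (lin (b ∷ d ∷ u ∷ δ ∷ β ∷ []) (λ b d u δ β → b :~ d ⊕ β ∷ d :~ u ⊕ δ ∷ [] ⊢ b :~ u ⊕ 𝟏 ⊕ (δ ⊕ β ⊖ 𝟏)) (b~ , d~ , tt))
    where
    u = x + α
    far : 1ℝ ≤ δ + β - ε
    far close = e≁b (between⇒near {e} {b} (between (δ + β - ε)
      (lin (δ ∷ β ∷ ε ∷ []) (λ δ β ε → 𝟎 :< δ ∷ 𝟎 :< β ∷ ε :< 𝟏 ∷ [] ⊢ ⊝ 𝟏 :< δ ⊕ β ⊖ ε) (0<δ , 0<β , ε<1 , tt))
      close
      (lin (b ∷ d ∷ u ∷ e ∷ δ ∷ β ∷ ε ∷ [])
        (λ b d u e δ β ε → b :~ d ⊕ β ∷ d :~ u ⊕ δ ∷ u ⊕ ε :~ e ∷ [] ⊢ b :~ e ⊕ (δ ⊕ β ⊖ ε))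
        (b~ , d~ , ~-sym {e} {u + ε} e~ , tt))))

  -- With u = x + α, the composite is the arc (u, u + 2); removing (u, u + 1) and (u + 1, u + 2)
  -- leaves the single point u + 1.
  Gap : ℝ → Rel ℝ 0ℓ
  Gap α x b = (ShiftedArc α ⨾ Arc) x b × ¬ ShiftedArc α x b × ¬ Arc (x + α + 1ℝ) b

  point-suc⇒ : ∀ {α x b} → b ~ x + α + 1ℝ → Gap α x b
  point-suc⇒ {α} {x} {b} b~u+1 = (let (d , between δ 0<δ δ<1 d~) = dense-between u {0ℝ} {1ℝ} 0<1 in
    d , between δ 0<δ δ<1 d~ , between (1ℝ - δ)
      (lin (δ ∷ []) (λ δ → δ :< 𝟏 ∷ [] ⊢ 𝟎 :< 𝟏 ⊖ δ) (δ<1 , tt))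
      (lin (δ ∷ []) (λ δ → 𝟎 :< δ ∷ [] ⊢ 𝟏 ⊖ δ :< 𝟏) (0<δ , tt))
      (lin (b ∷ u ∷ δ ∷ proj₁ d ∷ []) (λ b u δ d → b :~ u ⊕ 𝟏 ∷ u ⊕ δ :~ d ∷ [] ⊢ b :~ d ⊕ (𝟏 ⊖ δ))
        (b~u+1 , ~-sym {proj₁ d} {u + δ} d~ , tt))) ,
    (λ (between s 0<s s<1 b~u+s) → ~-gap-L {1ℝ} {s}
      (lin (b ∷ u ∷ s ∷ []) (λ b u s → u ⊕ 𝟏 :~ b ∷ b :~ u ⊕ s ∷ [] ⊢ 𝟏 :~ s) (~-sym {b} {u + 1ℝ} b~u+1 , b~u+s , tt))
      s<1
      (lin (s ∷ L ∷ []) (λ s L → 𝟎 :< s ∷ 𝟏 :< L ∷ [] ⊢ 𝟏 ⊖ s :< L) (0<s , 1<L , tt))) ,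
    (λ (between s 0<s s<1 b~u+1+s) → ~-gap-L {s} {0ℝ}
      (lin (b ∷ u ∷ s ∷ []) (λ b u s → u ⊕ 𝟏 ⊕ s :~ b ∷ b :~ u ⊕ 𝟏 ∷ [] ⊢ s :~ 𝟎)
        (~-sym {b} {u + 1ℝ + s} b~u+1+s , b~u+1 , tt))
      0<s
      (lin (s ∷ L ∷ []) (λ s L → s :< 𝟏 ∷ 𝟏 :< L ∷ [] ⊢ s ⊖ 𝟎 :< L) (s<1 , 1<L , tt)))
    where
    u = x + α

  point-suc⇐ : ∀ {α x b} → Gap α x b → b ~ x + α + 1ℝ
  point-suc⇐ {α} {x} {b} (((d , _) , between s 0<s s<1 d~ , between t 0<t t<1 b~) , not-before , not-after) =
    lin (b ∷ d ∷ u ∷ s ∷ t ∷ []) (λ b d u s t → b :~ d ⊕ t ∷ d :~ u ⊕ s ∷ s ⊕ t :≈ 𝟏 ∷ [] ⊢ b :~ u ⊕ 𝟏)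
      (b~ , d~ , ≤-antisym {s + t} {1ℝ}
        (λ 1<s+t → not-after (between (s + t - 1ℝ)
          (lin (s ∷ t ∷ []) (λ s t → 𝟏 :< s ⊕ t ∷ [] ⊢ 𝟎 :< s ⊕ t ⊖ 𝟏) (1<s+t , tt))
          (lin (s ∷ t ∷ []) (λ s t → s :< 𝟏 ∷ t :< 𝟏 ∷ [] ⊢ s ⊕ t ⊖ 𝟏 :< 𝟏) (s<1 , t<1 , tt))
          (lin (b ∷ d ∷ u ∷ s ∷ t ∷ []) (λ b d u s t → b :~ d ⊕ t ∷ d :~ u ⊕ s ∷ [] ⊢ b :~ u ⊕ 𝟏 ⊕ (s ⊕ t ⊖ 𝟏)) (b~ , d~ , tt))))
        (λ s+t<1 → not-before (between (s + t)
          (lin (s ∷ t ∷ []) (λ s t → 𝟎 :< s ∷ 𝟎 :< t ∷ [] ⊢ 𝟎 :< s ⊕ t) (0<s , 0<t , tt))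
          s+t<1
          (lin (b ∷ d ∷ u ∷ s ∷ t ∷ []) (λ b d u s t → b :~ d ⊕ t ∷ d :~ u ⊕ s ∷ [] ⊢ b :~ u ⊕ (s ⊕ t)) (b~ , d~ , tt)))) , tt)
    where
    u = x + α

  ⊔-lub-< : ∀ {l l′ u} → l < u → l′ < u → l ⊔ l′ < u
  ⊔-lub-< {l} {l′} {u} l<u l′<u = case compare l l′ of λ where
    (inj₁ l<l′) → lin (l ⊔ l′ ∷ l′ ∷ u ∷ []) (λ m l u → m :≤ l ∷ l :< u ∷ [] ⊢ m :< u)
      (⊔-lub {l} {l′} {l′} (<⇒≤ {l} {l′} l<l′) (lin (l′ ∷ []) (λ l → [] ⊢ l :≤ l) tt) , l′<u , tt)
    (inj₂ l′≤l) → lin (l ⊔ l′ ∷ l ∷ u ∷ []) (λ m l u → m :≤ l ∷ l :< u ∷ [] ⊢ m :< u)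
      (⊔-lub {l} {l′} {l} (lin (l ∷ []) (λ l → [] ⊢ l :≤ l) tt) l′≤l , l<u , tt)

-- Transport of orientation

module Orientation (em : ExcludedMiddle 0ℓ) (L : ℝ) (3<L : fromℤ (+ 3) < L)
                   (S : Pred ℝ 0ℓ) (dense : Dense L S) (p q : Σ ℝ S) where
  open Arcs em L 3<L S dense public

  -- Stage `k` of an inductive definition, of which each stage is first-order. The stages are
  -- cumulative, so one late stage can serve for all pairs.
  Directed : ℕ → Rel ℝ 0ℓ
  Directed zero    x y = x ~ proj₁ p × y ~ proj₁ q
  Directed (suc k) x y = Directed k x y ⊎
    (Near L x y × ((_≁_ ⨾ flip (Directed k)) x y ⊎ (flip (Directed k) ⨾ _≁_) x y))

  module _ (p→q : Arc (proj₁ p) (proj₁ q)) where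

    forward : ∀ {x y} → Near L x y → (∀ s → - 1ℝ < s → s ≤ 0ℝ → ¬ (y ~ x + s)) → Arc x y
    forward {x} {y} x~y ¬backward =
      let (between s -1<s s<1 y~) = near⇒between {x} {y} x~y in
      case compare 0ℝ s of λ where
        (inj₁ 0<s) → between s 0<s s<1 y~
        (inj₂ s≤0) → ⊥-elim (¬backward s -1<s s≤0 y~)

    directed⇒arc : ∀ k {x y} → Directed k x y → Arc x y
    directed⇒arc zero {x} {y} (x~p , y~q) = let (between s 0<s s<1 q~p+s) = p→q in
      between s 0<s s<1 (lin (proj₁ p ∷ proj₁ q ∷ x ∷ y ∷ s ∷ [])
        (λ p q x y s → q :~ p ⊕ s ∷ p :~ x ∷ y :~ q ∷ [] ⊢ y :~ x ⊕ s) (q~p+s , ~-sym {x} {proj₁ p} x~p , y~q , tt))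
    directed⇒arc (suc k) (inj₁ d) = directed⇒arc k d
    directed⇒arc (suc k) {x} {y} (inj₂ (x-y , inj₁ (z , x≁z , y→z))) =
      let (between t 0<t t<1 z~) = directed⇒arc k y→z in
      forward {x} {y} x-y λ s -1<s s≤0 y~ → x≁z (between⇒near {x} {proj₁ z} (between (s + t)
        (lin (s ∷ t ∷ []) (λ s t → ⊝ 𝟏 :< s ∷ 𝟎 :< t ∷ [] ⊢ ⊝ 𝟏 :< s ⊕ t) (-1<s , 0<t , tt))
        (lin (s ∷ t ∷ []) (λ s t → s :≤ 𝟎 ∷ t :< 𝟏 ∷ [] ⊢ s ⊕ t :< 𝟏) (s≤0 , t<1 , tt))
        (lin (x ∷ y ∷ proj₁ z ∷ s ∷ t ∷ []) (λ x y z s t → y :~ x ⊕ s ∷ z :~ y ⊕ t ∷ [] ⊢ z :~ x ⊕ (s ⊕ t)) (y~ , z~ , tt))))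
    directed⇒arc (suc k) {x} {y} (inj₂ (x-y , inj₂ (w , w→x , w≁y))) =
      let (between t 0<t t<1 x~) = directed⇒arc k w→x in
      forward {x} {y} x-y λ s -1<s s≤0 y~ → w≁y (between⇒near {proj₁ w} {y} (between (s + t)
        (lin (s ∷ t ∷ []) (λ s t → ⊝ 𝟏 :< s ∷ 𝟎 :< t ∷ [] ⊢ ⊝ 𝟏 :< s ⊕ t) (-1<s , 0<t , tt))
        (lin (s ∷ t ∷ []) (λ s t → s :≤ 𝟎 ∷ t :< 𝟏 ∷ [] ⊢ s ⊕ t :< 𝟏) (s≤0 , t<1 , tt))
        (lin (x ∷ y ∷ proj₁ w ∷ s ∷ t ∷ []) (λ x y w s t → y :~ x ⊕ s ∷ x :~ w ⊕ t ∷ [] ⊢ y :~ w ⊕ (s ⊕ t)) (y~ , x~ , tt))))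

    ¬near-far : ∀ {x y z} (x→y : Arc x y) (y→z : Arc y z) →
                1ℝ ≤ Between.offset x→y + Between.offset y→z → ¬ Near L x z
    ¬near-far {x} {y} {z} (between s _ s<1 y~) (between t _ t<1 z~) 1≤s+t = ¬near {x} {z} (s + t) 1≤s+t
      (lin (s ∷ t ∷ []) (λ s t → s :< 𝟏 ∷ t :< 𝟏 ∷ [] ⊢ s ⊕ t :< 𝟏 ⊕ 𝟏) (s<1 , t<1 , tt))
      (lin (x ∷ y ∷ z ∷ s ∷ t ∷ []) (λ x y z s t → y :~ x ⊕ s ∷ z :~ y ⊕ t ∷ [] ⊢ z :~ x ⊕ (s ⊕ t)) (y~ , z~ , tt))

    -- Two consecutive arcs of total length at least 1 have far ends, and this licenses passing the
    -- known direction from one to the other; here from the later to the earlier.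
    backwards : ∀ k {x y} (z : Point) (x→y : Arc x y) (y→z : Arc y (proj₁ z)) →
                1ℝ ≤ Between.offset x→y + Between.offset y→z → Directed k y (proj₁ z) → Directed (suc k) x y
    backwards k {x} {y} z x→y y→z far d =
      inj₂ (arc⇒near {x} {y} x→y , inj₁ (z , ¬near-far {x} {y} {proj₁ z} x→y y→z far , d))

    onwards : ∀ k {x y} (w : Point) (w→x : Arc (proj₁ w) x) (x→y : Arc x y) →
              1ℝ ≤ Between.offset w→x + Between.offset x→y → Directed k (proj₁ w) x → Directed (suc k) x y
    onwards k {x} {y} w w→x x→y far d =
      inj₂ (arc⇒near {x} {y} x→y , inj₂ (w , d , ¬near-far {proj₁ w} {x} {y} w→x x→y far))

    -- One known arc into `z` yields all of them, by going out and back: choose `y` so close to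
    -- `z + 1` that it is far from both `v` and `x`; then `v → z` gives `z → y`, which in turn gives
    -- `x → z`. The maximum `m` ensures both distances.
    fill-left : ∀ k (v : Point) {x z} → Directed k (proj₁ v) z → Arc x z → Directed (suc (suc k)) x z
    fill-left k v {x} {z} d (between s 0<s s<1 z~x+s) =
      let v→z@(between r 0<r r<1 z~v+r) = directed⇒arc k d
          m = (1ℝ - s) ⊔ (1ℝ - r)
          (y , between t m<t t<1 y~) = dense-between z {m} {1ℝ} (⊔-lub-< {1ℝ - s} {1ℝ - r} {1ℝ}
            (lin (s ∷ []) (λ s → 𝟎 :< s ∷ [] ⊢ 𝟏 ⊖ s :< 𝟏) (0<s , tt))
            (lin (r ∷ []) (λ s → 𝟎 :< s ∷ [] ⊢ 𝟏 ⊖ s :< 𝟏) (0<r , tt)))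
          z→y = between t
            (lin (s ∷ t ∷ m ∷ []) (λ s t m → s :< 𝟏 ∷ 𝟏 ⊖ s :≤ m ∷ m :< t ∷ [] ⊢ 𝟎 :< t)
              (s<1 , x≤x⊔y (1ℝ - s) (1ℝ - r) , m<t , tt)) t<1 y~
      in backwards (suc k) y (between s 0<s s<1 z~x+s) z→y
        (lin (s ∷ t ∷ m ∷ []) (λ s t m → 𝟏 ⊖ s :≤ m ∷ m :< t ∷ [] ⊢ 𝟏 :≤ s ⊕ t) (x≤x⊔y (1ℝ - s) (1ℝ - r) , m<t , tt))
        (onwards k v v→z z→y
          (lin (r ∷ t ∷ m ∷ []) (λ s t m → 𝟏 ⊖ s :≤ m ∷ m :< t ∷ [] ⊢ 𝟏 :≤ s ⊕ t) (y≤x⊔y (1ℝ - s) (1ℝ - r) , m<t , tt)) d)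

    -- A point `w` shortly after `z - 1` is far from `y`. Since `fill-left` already directs `w → z`,
    -- one further step directs `z → y`.
    fill-right : ∀ k (v : Point) {z y} → Directed k (proj₁ v) z → Arc z y → Directed (suc (suc (suc k))) z y
    fill-right k v {z} {y} d (between t 0<t t<1 y~) =
      let (w , between s -1<s s<t-1 w~) = dense-between z { - 1ℝ} {t - 1ℝ}
            (lin (t ∷ []) (λ t → 𝟎 :< t ∷ [] ⊢ ⊝ 𝟏 :< t ⊖ 𝟏) (0<t , tt))
          w→z = between (- s)
            (lin (s ∷ t ∷ []) (λ s t → s :< t ⊖ 𝟏 ∷ t :< 𝟏 ∷ [] ⊢ 𝟎 :< ⊝ s) (s<t-1 , t<1 , tt))
            (lin (s ∷ []) (λ s → ⊝ 𝟏 :< s ∷ [] ⊢ ⊝ s :< 𝟏) (-1<s , tt))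
            (lin (proj₁ w ∷ z ∷ s ∷ []) (λ w z s → z ⊕ s :~ w ∷ [] ⊢ z :~ w ⊕ (⊝ s)) (~-sym {proj₁ w} {z + s} w~ , tt))
      in onwards (suc (suc k)) w w→z (between t 0<t t<1 y~)
        (lin (s ∷ t ∷ []) (λ s t → s :< t ⊖ 𝟏 ∷ [] ⊢ 𝟏 :≤ ⊝ s ⊕ t) (s<t-1 , tt))
        (fill-left k v d w→z)

    Full : ℕ → ℝ → Set
    Full k z = ∀ {y} → Arc z y → Directed k z y

    -- Each use of `fill-right` costs three stages; the first one, at `q`, starts from stage 0.
    level : ℕ → ℕ
    level zero    = 3
    level (suc j) = suc (suc (suc (level j)))

    full-suc : ∀ k {z} → Full k z → Full (suc (suc (suc k))) z
    full-suc k f z→y = inj₁ (inj₁ (inj₁ (f z→y)))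

    full-q : ∀ j → Full (level j) (proj₁ q)
    full-q zero    = fill-right 0 p (~-refl {proj₁ p} , ~-refl {proj₁ q})
    full-q (suc j) = full-suc (level j) {proj₁ q} (full-q j)

    -- Induction on a bound for the offset from `q`. A point `x` in the newly added unit has a
    -- predecessor `c` in `S` that is within the old bound; all arcs out of `c` are directed, in
    -- particular `c → x`, and `fill-right` takes over at `x`.
    full : ∀ j {x} → Between 0ℝ (fromℤ (+ j)) (proj₁ q) x → Full (level j) x
    full zero    {x} (between u 0<u u<0 _) = ⊥-elim (<⇒≤ {0ℝ} {u} 0<u u<0)
    full (suc j) {x} (between u 0<u u<j+1 x~) = case compare u (fromℤ (+ j)) of λ where
      (inj₁ u<j) → full-suc (level j) {x} (full j {x} (between u 0<u u<j x~))
      (inj₂ j≤u) → case compare u 1ℝ of λ where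
        -- Here `u - 1` is negative, so a `c` taken from density could lie behind `q`; `q` itself is
        -- the predecessor.
        (inj₁ u<1) → fill-right (level j) q (full-q j (between u 0<u u<1 x~))
        (inj₂ 1≤u) →
          let (c , between t u-1<t t<j c~) = dense-between (proj₁ q) {u - 1ℝ} {fromℤ (+ j)}
                (lin (u ∷ fromℤ (+ suc j) ∷ fromℤ (+ j) ∷ []) (λ u j′ j → u :< j′ ∷ j′ :≈ j ⊕ 𝟏 ∷ [] ⊢ u ⊖ 𝟏 :< j)
                  (u<j+1 , fromℤ-suc j , tt))
              c→x : Arc (proj₁ c) x
              c→x = between (u - t)
                (lin (u ∷ t ∷ fromℤ (+ j) ∷ []) (λ u t j → t :< j ∷ j :≤ u ∷ [] ⊢ 𝟎 :< u ⊖ t) (t<j , j≤u , tt))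
                (lin (u ∷ t ∷ []) (λ u t → u ⊖ 𝟏 :< t ∷ [] ⊢ u ⊖ t :< 𝟏) (u-1<t , tt))
                (lin (x ∷ proj₁ q ∷ proj₁ c ∷ u ∷ t ∷ []) (λ x q c u t → x :~ q ⊕ u ∷ q ⊕ t :~ c ∷ [] ⊢ x :~ c ⊕ (u ⊖ t))
                  (x~ , ~-sym {proj₁ c} {proj₁ q + t} c~ , tt))
          in fill-right (level j) c (full j {proj₁ c} (between t
            (lin (u ∷ t ∷ []) (λ u t → 𝟏 :≤ u ∷ u ⊖ 𝟏 :< t ∷ [] ⊢ 𝟎 :< t) (1≤u , u-1<t , tt)) t<j c~) c→x)

    all-full : ∃[ k ] (∀ x → Full k x)
    all-full = let (j , 2L<j) = archimedean (L + L) in level j , λ x →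
      let (r , 0≤r , r<L , r~) = represent (x - proj₁ q) in
      -- The extra turn makes the offset positive even when `x` is the point `q`; hence the bound
      -- `L + L`.
      full j {x} (between (r + L)
        (lin (r ∷ L ∷ []) (λ r L → 𝟎 :≤ r ∷ 𝟎 :< L ∷ [] ⊢ 𝟎 :< r ⊕ L) (0≤r , 0<L , tt))
        (lin (r ∷ L ∷ fromℤ (+ j) ∷ []) (λ r L j → r :< L ∷ L ⊕ L :< j ∷ [] ⊢ r ⊕ L :< j) (r<L , 2L<j , tt))
        (lin (r ∷ L ∷ x ∷ proj₁ q ∷ []) (λ r L x q → x ⊖ q :~ r ∷ 𝟎 :~ L ∷ [] ⊢ x :~ q ⊕ (r ⊕ L))
          (~-sym {r} {x - proj₁ q} r~ , 0~L , tt)))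

-- Used because matching on z in a goal that mentions fromℤ z makes the type checker normalise reals.
ℕ-induction : {P : ℕ → Set} → P 0 → (∀ n → P n → P (suc n)) → ∀ n → P n
ℕ-induction base step zero    = base
ℕ-induction base step (suc n) = step n (ℕ-induction base step n)

ℤ-cases : {P : ℤ → Set} → (∀ n → P (+ n)) → (∀ n → P -[1+ n ]) → ∀ z → P z
ℤ-cases nonneg neg (+ n)    = nonneg n
ℤ-cases nonneg neg -[1+ n ] = neg n

-- Definable relations

module Definability (em : ExcludedMiddle 0ℓ) {Con : Set} (M : Structure Con) where

  open Structure M

  module _ {k : ℕ} where

    private variable
      P Q : Pred (Vec Carrier k) 0ℓ

    def-⇔ : (∀ v → P v ⇔ Q v) → Definable M k P → Definable M k Q
    def-⇔ e (φ , h) = φ , λ v → mk⇔ (to (e v) ∘ to (h v)) (from (h v) ∘ from (e v))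

    def-× : Definable M k P → Definable M k Q → Definable M k (λ v → P v × Q v)
    def-× (φ , h) (ψ , h′) = andF φ ψ , λ v → h v ×-⇔ h′ v

    def-⊎ : Definable M k P → Definable M k Q → Definable M k (λ v → P v ⊎ Q v)
    def-⊎ (φ , h) (ψ , h′) = orF φ ψ , λ v → h v ⊎-⇔ h′ v

    def-¬ : Definable M k P → Definable M k (λ v → ¬ P v)
    def-¬ (φ , h) = impF φ falseF , λ v → mk⇔ (_∘ from (h v)) (_∘ to (h v))

    def-∃ : {P : Pred (Vec Carrier (suc k)) 0ℓ} → Definable M (suc k) P → Definable M k (λ v → ∃[ x ] P (x ∷ v))
    def-∃ (φ , h) = exF φ , λ v → mk⇔ (map₂ (to (h _))) (map₂ (from (h _)))

    -- A proposition without free variables is decided outside the structure. This admits conditions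
    -- such as an inequality between integers and `L`, of which a formula cannot speak.
    def-const : (A : Set) → Definable M k (λ _ → A)
    def-const A with em {P = A}
    ... | yes a = impF falseF falseF , λ _ → mk⇔ (λ _ → a) (λ _ → id)
    ... | no ¬a = falseF , λ _ → mk⇔ (λ ()) ¬a

    -- The index is a numeral and not an element of the structure, so the quantifier over it becomes
    -- a finite disjunction.
    def-∃< : {P : ℕ → Pred (Vec Carrier k) 0ℓ} → (∀ i → Definable M k (P i)) →
             ∀ n → Definable M k (λ v → ∃[ i ] (i ℕ.< n × P i v))
    def-∃< d zero    = def-⇔ (λ v → mk⇔ ⊥-elim λ ()) (def-const ⊥)
    def-∃< {P} d (suc n) = def-⇔ (λ v → mk⇔ join split) (def-⊎ (def-∃< d n) (d n))
      where
      join : ∀ {v} → (∃[ i ] (i ℕ.< n × P i v)) ⊎ P n v → ∃[ i ] (i ℕ.< suc n × P i v)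
      join (inj₁ (i , i<n , p)) = i , ℕ.m<n⇒m<1+n i<n , p
      join (inj₂ p)             = n , ℕ.n<1+n n , p
      split : ∀ {v} → ∃[ i ] (i ℕ.< suc n × P i v) → (∃[ i ] (i ℕ.< n × P i v)) ⊎ P n v
      split (i , i<1+n , p) with ℕ.m≤n⇒m<n∨m≡n (ℕ.s≤s⁻¹ i<1+n)
      ... | inj₁ i<n  = inj₁ (i , i<n , p)
      ... | inj₂ refl = inj₂ p

-- Formulas for arcs and integer shifts

module Constants (em : ExcludedMiddle 0ℓ) (L : ℝ) (3<L : fromℤ (+ 3) < L)
                 (S : Pred ℝ 0ℓ) (dense : Dense L S) {Con : Set} (a : Con → Σ ℝ S) (c c′ : Con) where
  open Orientation em L 3<L S dense (a c) (a c′) public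
  open Definability em (structure-S_L L S a) public

  private
    M = structure-S_L L S a

  -- Quantifying over all pairs of variables makes renaming of formulas unnecessary.
  record Definable₂ (R : Rel ℝ 0ℓ) : Set where
    constructor definable₂
    field
      at : ∀ {k} (i j : Fin k) → Definable M k (λ v → R (proj₁ (lookup v i)) (proj₁ (lookup v j)))

  open Definable₂

  def₂-⇔ : {R Q : Rel ℝ 0ℓ} → (∀ (x y : Point) → R (proj₁ x) (proj₁ y) ⇔ Q (proj₁ x) (proj₁ y)) →
           Definable₂ R → Definable₂ Q
  def₂-⇔ {R} {Q} e d = definable₂ λ i j → def-⇔ (λ v → e (lookup v i) (lookup v j)) (at d i j)

  near-definable : Definable₂ (Near L)
  at near-definable i j = relF (var i) (var j) , λ v → mk⇔ id id

  same-definable : Definable₂ _~_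
  at same-definable i j = eqF (var i) (var j) , λ v → mk⇔ id id

  module _ {R Q : Rel ℝ 0ℓ} (d : Definable₂ R) (e : Definable₂ Q) where

    def₂-× : Definable₂ (λ x y → R x y × Q x y)
    at def₂-× i j = def-× (at d i j) (at e i j)

    def₂-⊎ : Definable₂ (λ x y → R x y ⊎ Q x y)
    at def₂-⊎ i j = def-⊎ (at d i j) (at e i j)

    def₂-⨾ : Definable₂ (R ⨾ Q)
    at def₂-⨾ i j = def-∃ (def-× (at d (suc i) zero) (at e zero (suc j)))

  module _ {R : Rel ℝ 0ℓ} (d : Definable₂ R) where

    def₂-¬ : Definable₂ (λ x y → ¬ R x y)
    at def₂-¬ i j = def-¬ (at d i j)

    def₂-flip : Definable₂ (λ x y → R y x)
    at def₂-flip i j = at d j i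

  far-definable : Definable₂ _≁_
  far-definable = def₂-¬ near-definable

  directed-definable : ∀ k → Definable₂ (Directed k)
  at (directed-definable zero) i j = andF (eqF (var i) (con c)) (eqF (var j) (con c′)) , λ v → mk⇔ id id
  directed-definable (suc k) = def₂-⊎ (directed-definable k) (def₂-× near-definable
    (def₂-⊎ (def₂-⨾ far-definable (def₂-flip (directed-definable k)))
            (def₂-⨾ (def₂-flip (directed-definable k)) far-definable)))

  arc-resp : ∀ {u u′ y} → u ~ u′ → Arc u y → Arc u′ y
  arc-resp {u} {u′} {y} u~u′ (between s 0<s s<1 y~) = between s 0<s s<1
    (lin (u ∷ u′ ∷ y ∷ s ∷ []) (λ u u′ y s → y :~ u ⊕ s ∷ u :~ u′ ∷ [] ⊢ y :~ u′ ⊕ s) (y~ , u~u′ , tt))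

  +-suc-~ : ∀ x n → x + fromℤ (+ suc n) ~ x + fromℤ (+ n) + 1ℝ
  +-suc-~ x n = lin (x ∷ fromℤ (+ suc n) ∷ fromℤ (+ n) ∷ []) (λ x n′ n → n′ :≈ n ⊕ 𝟏 ∷ [] ⊢ x ⊕ n′ :~ x ⊕ n ⊕ 𝟏) (fromℤ-suc n , tt)

  ShiftedPoint : ℝ → Rel ℝ 0ℓ
  ShiftedPoint α x y = y ~ x + α

  +0-~ : ∀ x → x ~ x + fromℤ (+ 0)
  +0-~ x = lin (x ∷ fromℤ (+ 0) ∷ []) (λ x n → 𝟎 :≈ n ∷ [] ⊢ x :~ x ⊕ n) (≡⇒≈ {0ℝ} {fromℤ (+ 0)} (λ _ → refl) , tt)

  arc-+0 : ∀ x y → Arc x y ⇔ Arc (x + fromℤ (+ 0)) y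
  arc-+0 x y = mk⇔ (arc-resp {x} {u} {y} (+0-~ x)) (arc-resp {u} {x} {y} (~-sym {x} {u} (+0-~ x)))
    where
    u = x + fromℤ (+ 0)

  arc-+1⇔ : ∀ n x y → Arc (x + fromℤ (+ n) + 1ℝ) y ⇔ Arc (x + fromℤ (+ suc n)) y
  arc-+1⇔ n x y = mk⇔ (arc-resp {v} {u} {y} (~-sym {u} {v} (+-suc-~ x n))) (arc-resp {u} {v} {y} (+-suc-~ x n))
    where
    u = x + fromℤ (+ suc n)
    v = x + fromℤ (+ n) + 1ℝ

  arc-+suc : ∀ n x y → NextArc (fromℤ (+ n)) x y ⇔ Arc (x + fromℤ (+ suc n)) y
  arc-+suc n x y = mk⇔
    (to (arc-+1⇔ n x y) ∘ arc-suc⇐ {fromℤ (+ n)} {x} {y})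
    (arc-suc⇒ {fromℤ (+ n)} {x} {y} ∘ from (arc-+1⇔ n x y))

  point-+0 : ∀ x y → y ~ x ⇔ y ~ x + fromℤ (+ 0)
  point-+0 x y = mk⇔
    (λ y~x → lin (y ∷ x ∷ u ∷ []) (λ y x u → y :~ x ∷ x :~ u ∷ [] ⊢ y :~ u) (y~x , +0-~ x , tt))
    (λ y~u → lin (y ∷ x ∷ u ∷ []) (λ y x u → y :~ u ∷ u :~ x ∷ [] ⊢ y :~ x) (y~u , ~-sym {x} {u} (+0-~ x) , tt))
    where
    u = x + fromℤ (+ 0)

  NextPoint : ℕ → Rel ℝ 0ℓ
  NextPoint n x y = (ShiftedArc (fromℤ (+ n)) ⨾ Arc) x y ×
    ¬ ShiftedArc (fromℤ (+ n)) x y × ¬ ShiftedArc (fromℤ (+ suc n)) x y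

  gap⇔next-point : ∀ n x y → Gap (fromℤ (+ n)) x y ⇔ NextPoint n x y
  gap⇔next-point n x y = mk⇔
    (λ (d , ¬x→y , ¬x+1→y) → d , ¬x→y , λ x→y → ¬x+1→y (from (arc-+1⇔ n x y) x→y))
    (λ (d , ¬x→y , ¬x+1→y) → d , ¬x→y , λ x→y → ¬x+1→y (to (arc-+1⇔ n x y) x→y))

  point-+1⇔ : ∀ n x y → y ~ x + fromℤ (+ n) + 1ℝ ⇔ y ~ x + fromℤ (+ suc n)
  point-+1⇔ n x y = mk⇔
    (λ y~v → lin (y ∷ v ∷ u ∷ []) (λ y v u → y :~ v ∷ v :~ u ∷ [] ⊢ y :~ u) (y~v , ~-sym {u} {v} (+-suc-~ x n) , tt))
    (λ y~u → lin (y ∷ u ∷ v ∷ []) (λ y u v → y :~ u ∷ u :~ v ∷ [] ⊢ y :~ v) (y~u , +-suc-~ x n , tt))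
    where
    u = x + fromℤ (+ suc n)
    v = x + fromℤ (+ n) + 1ℝ

  point-+suc : ∀ n x y → NextPoint n x y ⇔ y ~ x + fromℤ (+ suc n)
  point-+suc n x y = mk⇔
    (λ p → to (point-+1⇔ n x y) (point-suc⇐ {fromℤ (+ n)} {x} {y} (from (gap⇔next-point n x y) p)))
    (λ p → to (gap⇔next-point n x y) (point-suc⇒ {fromℤ (+ n)} {x} {y} (from (point-+1⇔ n x y) p)))

  -- x - (1 + n) + s = y  iff  y + n + (1 - s) = x
  arc-flip : ∀ n {x y} → Arc (x + fromℤ (+ n)) y → Arc (y + fromℤ -[1+ n ]) x
  arc-flip n {x} {y} (between s 0<s s<1 y~) = between (1ℝ - s)
    (lin (s ∷ []) (λ s → s :< 𝟏 ∷ [] ⊢ 𝟎 :< 𝟏 ⊖ s) (s<1 , tt))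
    (lin (s ∷ []) (λ s → 𝟎 :< s ∷ [] ⊢ 𝟏 ⊖ s :< 𝟏) (0<s , tt))
    (lin (x ∷ y ∷ s ∷ fromℤ (+ n) ∷ fromℤ (+ suc n) ∷ fromℤ -[1+ n ] ∷ [])
      (λ x y s n n′ -n′ → x ⊕ n ⊕ s :~ y ∷ 𝟎 ⊖ n′ :≈ -n′ ∷ n′ :≈ n ⊕ 𝟏 ∷ [] ⊢ x :~ y ⊕ -n′ ⊕ (𝟏 ⊖ s))
      (~-sym {y} {x + fromℤ (+ n) + s} y~ , ≈-sym {fromℤ -[1+ n ]} {0ℝ - fromℤ (+ suc n)} (fromℤ-neg (+ suc n)) , fromℤ-suc n , tt))

  arc-unflip : ∀ n {x y} → Arc (y + fromℤ -[1+ n ]) x → Arc (x + fromℤ (+ n)) y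
  arc-unflip n {x} {y} (between s 0<s s<1 x~) = between (1ℝ - s)
    (lin (s ∷ []) (λ s → s :< 𝟏 ∷ [] ⊢ 𝟎 :< 𝟏 ⊖ s) (s<1 , tt))
    (lin (s ∷ []) (λ s → 𝟎 :< s ∷ [] ⊢ 𝟏 ⊖ s :< 𝟏) (0<s , tt))
    (lin (x ∷ y ∷ s ∷ fromℤ (+ n) ∷ fromℤ (+ suc n) ∷ fromℤ -[1+ n ] ∷ [])
      (λ x y s n n′ -n′ → y ⊕ -n′ ⊕ s :~ x ∷ 𝟎 ⊖ n′ :≈ -n′ ∷ n′ :≈ n ⊕ 𝟏 ∷ [] ⊢ y :~ x ⊕ n ⊕ (𝟏 ⊖ s))
      (~-sym {x} {y + fromℤ -[1+ n ] + s} x~ , ≈-sym {fromℤ -[1+ n ]} {0ℝ - fromℤ (+ suc n)} (fromℤ-neg (+ suc n)) , fromℤ-suc n , tt))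

  point-flip : ∀ n {x y} → y ~ x + fromℤ (+ suc n) → x ~ y + fromℤ -[1+ n ]
  point-flip n {x} {y} y~ = lin (x ∷ y ∷ fromℤ (+ suc n) ∷ fromℤ -[1+ n ] ∷ [])
    (λ x y n′ -n′ → x ⊕ n′ :~ y ∷ 𝟎 ⊖ n′ :≈ -n′ ∷ [] ⊢ x :~ y ⊕ -n′)
    (~-sym {y} {x + fromℤ (+ suc n)} y~ , ≈-sym {fromℤ -[1+ n ]} {0ℝ - fromℤ (+ suc n)} (fromℤ-neg (+ suc n)) , tt)

  point-unflip : ∀ n {x y} → x ~ y + fromℤ -[1+ n ] → y ~ x + fromℤ (+ suc n)
  point-unflip n {x} {y} x~ = lin (x ∷ y ∷ fromℤ (+ suc n) ∷ fromℤ -[1+ n ] ∷ [])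
    (λ x y n′ -n′ → y ⊕ -n′ :~ x ∷ 𝟎 ⊖ n′ :≈ -n′ ∷ [] ⊢ y :~ x ⊕ n′)
    (~-sym {x} {y + fromℤ -[1+ n ]} x~ , ≈-sym {fromℤ -[1+ n ]} {0ℝ - fromℤ (+ suc n)} (fromℤ-neg (+ suc n)) , tt)

  -- The circular order from rounded offsets

  record HalfOpenArc (x y : ℝ) : Set where
    constructor half-open
    field
      offset  : ℝ
      lower   : 0ℝ < offset
      upper   : offset ≤ 1ℝ
      reaches : y ~ x + offset

  half-open-split : ∀ {u y} → HalfOpenArc u y → Arc u y ⊎ y ~ u + 1ℝ
  half-open-split {u} {y} (half-open s 0<s s≤1 y~) = case compare s 1ℝ of λ where
    (inj₁ s<1) → inj₁ (between s 0<s s<1 y~)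
    (inj₂ 1≤s) → inj₂ (lin (u ∷ y ∷ s ∷ []) (λ u y s → y :~ u ⊕ s ∷ s :≈ 𝟏 ∷ [] ⊢ y :~ u ⊕ 𝟏)
      (y~ , ≤-antisym {s} {1ℝ} s≤1 1≤s , tt))

  half-open-join : ∀ {u y} → Arc u y ⊎ y ~ u + 1ℝ → HalfOpenArc u y
  half-open-join (inj₁ (between s 0<s s<1 y~)) = half-open s 0<s (<⇒≤ {s} {1ℝ} s<1) y~
  half-open-join (inj₂ y~)                     = half-open 1ℝ 0<1 (lin [] ([] ⊢ 𝟏 :≤ 𝟏) tt) y~

  half-open-⇔ : ∀ z x y → (Arc (x + fromℤ z) y ⊎ y ~ x + fromℤ (z ℤ.+ + 1)) ⇔ HalfOpenArc (x + fromℤ z) y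
  half-open-⇔ z x y = mk⇔ (half-open-join ∘ map₂⊎ forth) (map₂⊎ back ∘ half-open-split)
    where
    forth : y ~ x + fromℤ (z ℤ.+ + 1) → y ~ x + fromℤ z + 1ℝ
    forth y~ = lin (x ∷ y ∷ fromℤ z ∷ fromℤ (z ℤ.+ + 1) ∷ [])
      (λ x y z z′ → y :~ x ⊕ z′ ∷ z′ :≈ z ⊕ 𝟏 ∷ [] ⊢ y :~ x ⊕ z ⊕ 𝟏) (y~ , fromℤ-+ z (+ 1) , tt)
    back : y ~ x + fromℤ z + 1ℝ → y ~ x + fromℤ (z ℤ.+ + 1)
    back y~ = lin (x ∷ y ∷ fromℤ z ∷ fromℤ (z ℤ.+ + 1) ∷ [])
      (λ x y z z′ → y :~ x ⊕ z ⊕ 𝟏 ∷ z ⊕ 𝟏 :≈ z′ ∷ [] ⊢ y :~ x ⊕ z′)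
      (y~ , ≈-sym {fromℤ (z ℤ.+ + 1)} {fromℤ z + 1ℝ} (fromℤ-+ z (+ 1)) , tt)

  -- The number is ⌈s⌉ - 1 and not ⌊s⌋: the intervals (n, n + 1] tile the positive reals, integers
  -- included, and lower ends strictly below three offsets with sum `L` add up to strictly less than
  -- `L`.
  record Floor (n : ℕ) (s : ℝ) : Set where
    constructor floored
    field
      floor   : ℕ
      floor<n : floor ℕ.< n
      lower   : fromℤ (+ floor) < s
      upper   : s ≤ fromℤ (+ floor) + 1ℝ

  floor : ∀ n {s} → 0ℝ < s → s ≤ fromℤ (+ n) → Floor n s
  floor zero        0<s s≤0 = ⊥-elim (s≤0 0<s)
  floor (suc n) {s} 0<s s≤1+n = case compare (fromℤ (+ n)) s of λ where
    (inj₁ n<s) → floored n (ℕ.n<1+n n) n<s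
      (lin (s ∷ fromℤ (+ n) ∷ fromℤ (+ suc n) ∷ []) (λ s n n′ → s :≤ n′ ∷ n′ :≈ n ⊕ 𝟏 ∷ [] ⊢ s :≤ n ⊕ 𝟏)
        (s≤1+n , fromℤ-suc n , tt))
    (inj₂ s≤n) → let (floored i i<n i<s s≤i+1) = floor n {s} 0<s s≤n in floored i (ℕ.m<n⇒m<1+n i<n) i<s s≤i+1

  0≤fromℤ : ∀ n → 0ℝ ≤ fromℤ (+ n)
  0≤fromℤ zero    = lin [] ([] ⊢ 𝟎 :≤ 𝟎) tt
  0≤fromℤ (suc n) = lin (fromℤ (+ n) ∷ fromℤ (+ suc n) ∷ []) (λ n n′ → 𝟎 :≤ n ∷ n ⊕ 𝟏 :≈ n′ ∷ [] ⊢ 𝟎 :≤ n′)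
    (0≤fromℤ n , ≈-sym {fromℤ (+ suc n)} {fromℤ (+ n) + 1ℝ} (fromℤ-suc n) , tt)

  fromℤ-difference : ∀ z t i → fromℤ (z ℤ.- t ℤ.+ i) ≈ fromℤ z - fromℤ t + fromℤ i
  fromℤ-difference z t i = lin (fromℤ (z ℤ.- t ℤ.+ i) ∷ fromℤ (z ℤ.- t) ∷ fromℤ (ℤ.- t) ∷ fromℤ z ∷ fromℤ t ∷ fromℤ i ∷ [])
    (λ zti zt -t z t i → zti :≈ zt ⊕ i ∷ zt :≈ z ⊕ -t ∷ -t :≈ 𝟎 ⊖ t ∷ [] ⊢ zti :≈ z ⊖ t ⊕ i)
    (fromℤ-+ (z ℤ.- t) i , fromℤ-+ z (ℤ.- t) , fromℤ-neg t , tt)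

  shift-half-open : ∀ {x y s} z t i → fromℤ (+ i) < s → s ≤ fromℤ (+ i) + 1ℝ → shift L t y ~ shift L z x + s →
                    HalfOpenArc (x + fromℤ (z ℤ.- t ℤ.+ + i)) y
  shift-half-open {x} {y} {s} z t i i<s s≤i+1 reaches = half-open (s - fromℤ (+ i))
    (lin (s ∷ fromℤ (+ i) ∷ []) (λ s i → i :< s ∷ [] ⊢ 𝟎 :< s ⊖ i) (i<s , tt))
    (lin (s ∷ fromℤ (+ i) ∷ []) (λ s i → s :≤ i ⊕ 𝟏 ∷ [] ⊢ s ⊖ i :≤ 𝟏) (s≤i+1 , tt))
    (lin (x ∷ y ∷ s ∷ fromℤ z ∷ fromℤ t ∷ fromℤ (+ i) ∷ w ∷ [])
      (λ x y s z t i w → y ⊕ t :~ x ⊕ z ⊕ s ∷ z ⊖ t ⊕ i :≈ w ∷ [] ⊢ y :~ x ⊕ w ⊕ (s ⊖ i))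
      (reaches , ≈-sym {w} {fromℤ z - fromℤ t + fromℤ (+ i)} (fromℤ-difference z t (+ i)) , tt))
    where
    w = fromℤ (z ℤ.- t ℤ.+ + i)

  half-open-shift : ∀ {x y σ} z t i → y ~ x + fromℤ (z ℤ.- t ℤ.+ + i) + σ →
                    shift L t y ~ shift L z x + (fromℤ (+ i) + σ)
  half-open-shift {x} {y} {σ} z t i reaches = lin
    (x ∷ y ∷ σ ∷ fromℤ z ∷ fromℤ t ∷ fromℤ (+ i) ∷ fromℤ (z ℤ.- t ℤ.+ + i) ∷ [])
    (λ x y σ z t i w → y :~ x ⊕ w ⊕ σ ∷ w :≈ z ⊖ t ⊕ i ∷ [] ⊢ y ⊕ t :~ x ⊕ z ⊕ (i ⊕ σ))
    (reaches , fromℤ-difference z t (+ i) , tt)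

  -- The points `a + z`, `b + t`, `c + k` may lie outside `S`. An offset `s` from `a + z` to `b + t`
  -- is an offset `z - t + s` from `a` to `b`, so all shifts are absorbed into the integers attached
  -- to `a`, `b`, `c`.
  Circuit : ℕ → ℤ → ℤ → ℤ → ℝ → ℝ → ℝ → Set
  Circuit N z t k a b c = ∃[ i ] (i ℕ.< N × ∃[ j ] (j ℕ.< N × ∃[ l ] (l ℕ.< N ×
    (fromℤ (+ i) + fromℤ (+ j) + fromℤ (+ l) < L ×
     HalfOpenArc (a + fromℤ (z ℤ.- t ℤ.+ + i)) b ×
     HalfOpenArc (b + fromℤ (t ℤ.- k ℤ.+ + j)) c ×
     HalfOpenArc (c + fromℤ (k ℤ.- z ℤ.+ + l)) a))))

  C⇒circuit : ∀ {N} → L ≤ fromℤ (+ N) → ∀ z t k {a b c} →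
              C L (shift L z a) (shift L t b) (shift L k c) → Circuit N z t k a b c
  C⇒circuit {N} L≤N z t k {a} {b} {c} abc =
    let (cycle s₁ s₂ s₃ 0<s₁ 0<s₂ 0<s₃ r₁ r₂ r₃ once) = C⇒cycle {shift L z a} {shift L t b} {shift L k c} abc
        -- Each offset is at most one whole turn, so indices below `N` suffice and the disjunction
        -- over them is finite.
        sum≤N : s₁ + s₂ + s₃ ≤ fromℤ (+ N)
        sum≤N = lin (s₁ ∷ s₂ ∷ s₃ ∷ L ∷ fromℤ (+ N) ∷ [])
          (λ s₁ s₂ s₃ L N → s₁ ⊕ s₂ ⊕ s₃ :≈ L ∷ L :≤ N ∷ [] ⊢ s₁ ⊕ s₂ ⊕ s₃ :≤ N) (once , L≤N , tt)
        (floored i i<N i<s₁ s₁≤i+1) = floor N {s₁} 0<s₁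
          (lin (s₁ ∷ s₂ ∷ s₃ ∷ fromℤ (+ N) ∷ []) (λ s₁ s₂ s₃ N → s₁ ⊕ s₂ ⊕ s₃ :≤ N ∷ 𝟎 :< s₂ ∷ 𝟎 :< s₃ ∷ [] ⊢ s₁ :≤ N) (sum≤N , 0<s₂ , 0<s₃ , tt))
        (floored j j<N j<s₂ s₂≤j+1) = floor N {s₂} 0<s₂
          (lin (s₁ ∷ s₂ ∷ s₃ ∷ fromℤ (+ N) ∷ []) (λ s₁ s₂ s₃ N → s₁ ⊕ s₂ ⊕ s₃ :≤ N ∷ 𝟎 :< s₁ ∷ 𝟎 :< s₃ ∷ [] ⊢ s₂ :≤ N) (sum≤N , 0<s₁ , 0<s₃ , tt))
        (floored l l<N l<s₃ s₃≤l+1) = floor N {s₃} 0<s₃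
          (lin (s₁ ∷ s₂ ∷ s₃ ∷ fromℤ (+ N) ∷ []) (λ s₁ s₂ s₃ N → s₁ ⊕ s₂ ⊕ s₃ :≤ N ∷ 𝟎 :< s₁ ∷ 𝟎 :< s₂ ∷ [] ⊢ s₃ :≤ N) (sum≤N , 0<s₁ , 0<s₂ , tt))
        i+j+l<L : fromℤ (+ i) + fromℤ (+ j) + fromℤ (+ l) < L
        i+j+l<L = lin (s₁ ∷ s₂ ∷ s₃ ∷ L ∷ fromℤ (+ i) ∷ fromℤ (+ j) ∷ fromℤ (+ l) ∷ [])
          (λ s₁ s₂ s₃ L i j l → i :< s₁ ∷ j :< s₂ ∷ l :< s₃ ∷ s₁ ⊕ s₂ ⊕ s₃ :≈ L ∷ [] ⊢ i ⊕ j ⊕ l :< L)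
          (i<s₁ , j<s₂ , l<s₃ , once , tt)
    in i , i<N , j , j<N , l , l<N , i+j+l<L ,
       shift-half-open {a} {b} {s₁} z t i i<s₁ s₁≤i+1 r₁ ,
       shift-half-open {b} {c} {s₂} t k j j<s₂ s₂≤j+1 r₂ ,
       shift-half-open {c} {a} {s₃} k z l l<s₃ s₃≤l+1 r₃

  circuit⇒C : ∀ {N} z t k {a b c} → Circuit N z t k a b c → C L (shift L z a) (shift L t b) (shift L k c)
  circuit⇒C z t k {a} {b} {c} (i , _ , j , _ , l , _ , i+j+l<L ,
      half-open σ₁ 0<σ₁ σ₁≤1 r₁ , half-open σ₂ 0<σ₂ σ₂≤1 r₂ , half-open σ₃ 0<σ₃ σ₃≤1 r₃) =
    cycle⇒C {shift L z a} {shift L t b} {shift L k c}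
      (cycle (fromℤ (+ i) + σ₁) (fromℤ (+ j) + σ₂) (fromℤ (+ l) + σ₃)
        (positive i {σ₁} 0<σ₁) (positive j {σ₂} 0<σ₂) (positive l {σ₃} 0<σ₃) r₁′ r₂′ r₃′
        (once-around {shift L z a} {shift L t b} {shift L k c} {fromℤ (+ i) + σ₁} {fromℤ (+ j) + σ₂} {fromℤ (+ l) + σ₃}
          (lin (fromℤ (+ i) + σ₁ ∷ fromℤ (+ j) + σ₂ ∷ fromℤ (+ l) + σ₃ ∷ [])
            (λ x y z → 𝟎 :< x ∷ 𝟎 :< y ∷ 𝟎 :< z ∷ [] ⊢ 𝟎 :< x ⊕ y ⊕ z) (positive i {σ₁} 0<σ₁ , positive j {σ₂} 0<σ₂ , positive l {σ₃} 0<σ₃ , tt))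
          -- The lower ends contribute less than `L` and the three remainders at most 3, so a second
          -- turn is excluded.
          (lin (fromℤ (+ i) ∷ fromℤ (+ j) ∷ fromℤ (+ l) ∷ σ₁ ∷ σ₂ ∷ σ₃ ∷ L ∷ [])
            (λ i j l σ₁ σ₂ σ₃ L → i ⊕ j ⊕ l :< L ∷ σ₁ :≤ 𝟏 ∷ σ₂ :≤ 𝟏 ∷ σ₃ :≤ 𝟏 ∷ 𝟏 ⊕ 𝟏 ⊕ 𝟏 :< L ∷ []
              ⊢ i ⊕ σ₁ ⊕ (j ⊕ σ₂) ⊕ (l ⊕ σ₃) :< L ⊕ L)
            (i+j+l<L , σ₁≤1 , σ₂≤1 , σ₃≤1 , 3<L′ , tt))
          r₁′ r₂′ r₃′))
    where
    positive : ∀ i {σ} → 0ℝ < σ → 0ℝ < fromℤ (+ i) + σ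
    positive i {σ} 0<σ = lin (fromℤ (+ i) ∷ σ ∷ []) (λ i σ → 𝟎 :≤ i ∷ 𝟎 :< σ ∷ [] ⊢ 𝟎 :< i ⊕ σ) (0≤fromℤ i , 0<σ , tt)
    r₁′ = half-open-shift {a} {b} {σ₁} z t i r₁
    r₂′ = half-open-shift {b} {c} {σ₂} t k j r₂
    r₃′ = half-open-shift {c} {a} {σ₃} k z l r₃

  module _ (p→q : Arc (proj₁ (a c)) (proj₁ (a c′))) where

    arc-definable : Definable₂ Arc
    arc-definable = let (k , full) = all-full p→q in
      def₂-⇔ {Directed k} {Arc} (λ x y → mk⇔ (directed⇒arc p→q k) (full (proj₁ x))) (directed-definable k)

    shifted-arc-definable-0 : Definable₂ (ShiftedArc (fromℤ (+ 0)))
    shifted-arc-definable-0 = def₂-⇔ {Arc} {ShiftedArc (fromℤ (+ 0))}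
      (λ x y → arc-+0 (proj₁ x) (proj₁ y)) arc-definable

    shifted-arc-definable-suc : ∀ n → Definable₂ (ShiftedArc (fromℤ (+ n))) → Definable₂ (ShiftedArc (fromℤ (+ suc n)))
    shifted-arc-definable-suc n d = def₂-⇔ {NextArc (fromℤ (+ n))} {ShiftedArc (fromℤ (+ suc n))}
      (λ x y → arc-+suc n (proj₁ x) (proj₁ y))
      (def₂-× (def₂-⨾ d arc-definable) (def₂-⨾ d far-definable))

    shifted-arc-definable-ℕ : ∀ n → Definable₂ (ShiftedArc (fromℤ (+ n)))
    shifted-arc-definable-ℕ = ℕ-induction {λ n → Definable₂ (ShiftedArc (fromℤ (+ n)))}
      shifted-arc-definable-0 shifted-arc-definable-suc

    shifted-arc-definable-neg : ∀ n → Definable₂ (ShiftedArc (fromℤ -[1+ n ]))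
    shifted-arc-definable-neg n = def₂-⇔ {flip (ShiftedArc (fromℤ (+ n)))} {ShiftedArc (fromℤ -[1+ n ])}
      (λ x y → mk⇔ (arc-flip n {proj₁ y} {proj₁ x}) (arc-unflip n {proj₁ y} {proj₁ x}))
      (def₂-flip (shifted-arc-definable-ℕ n))

    shifted-arc-definable : ∀ z → Definable₂ (ShiftedArc (fromℤ z))
    shifted-arc-definable = ℤ-cases {λ z → Definable₂ (ShiftedArc (fromℤ z))}
      shifted-arc-definable-ℕ shifted-arc-definable-neg

    shift-definable-0 : Definable₂ (ShiftedPoint (fromℤ (+ 0)))
    shift-definable-0 = def₂-⇔ {λ x y → y ~ x} {ShiftedPoint (fromℤ (+ 0))}
      (λ x y → point-+0 (proj₁ x) (proj₁ y)) (def₂-flip same-definable)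

    shift-definable-suc : ∀ n → Definable₂ (ShiftedPoint (fromℤ (+ suc n)))
    shift-definable-suc n = def₂-⇔ {NextPoint n} {ShiftedPoint (fromℤ (+ suc n))}
      (λ x y → point-+suc n (proj₁ x) (proj₁ y))
      (def₂-× (def₂-⨾ (shifted-arc-definable-ℕ n) arc-definable)
        (def₂-× (def₂-¬ (shifted-arc-definable-ℕ n)) (def₂-¬ (shifted-arc-definable-ℕ (suc n)))))

    shift-definable-neg : ∀ n → Definable₂ (ShiftedPoint (fromℤ -[1+ n ]))
    shift-definable-neg n = def₂-⇔ {flip (ShiftedPoint (fromℤ (+ suc n)))} {ShiftedPoint (fromℤ -[1+ n ])}
      (λ x y → mk⇔ (point-flip n {proj₁ y} {proj₁ x}) (point-unflip n {proj₁ y} {proj₁ x}))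
      (def₂-flip (shift-definable-suc n))

    shift-definable : ∀ z → Definable₂ (ShiftedPoint (fromℤ z))
    shift-definable = ℤ-cases {λ z → Definable₂ (ShiftedPoint (fromℤ z))}
      (ℕ-induction {λ n → Definable₂ (ShiftedPoint (fromℤ (+ n)))} shift-definable-0 λ n _ → shift-definable-suc n)
      shift-definable-neg

    half-open-definable : ∀ z → Definable₂ (λ x y → HalfOpenArc (x + fromℤ z) y)
    half-open-definable z =
      def₂-⇔ {λ x y → ShiftedArc (fromℤ z) x y ⊎ ShiftedPoint (fromℤ (z ℤ.+ + 1)) x y} {λ x y → HalfOpenArc (x + fromℤ z) y}
        (λ x y → half-open-⇔ z (proj₁ x) (proj₁ y))
        (def₂-⊎ (shifted-arc-definable z) (shift-definable (z ℤ.+ + 1)))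

    f-graph-⇔ : ∀ z v → ShiftedPoint (fromℤ z) (proj₁ (lookup v zero)) (proj₁ (lookup v (suc zero))) ⇔ f-graph L S z v
    f-graph-⇔ z ((x , _) ∷ (y , _) ∷ []) = mk⇔ id id

    f-definable : ∀ z → Definable M 2 (f-graph L S z)
    f-definable z = def-⇔ (f-graph-⇔ z) (at (shift-definable z) zero (suc zero))

    HalfOpenᵥ : ℤ → Fin 3 → Fin 3 → Pred (Vec (Structure.Carrier M) 3) 0ℓ
    HalfOpenᵥ w p q v = HalfOpenArc (proj₁ (lookup v p) + fromℤ w) (proj₁ (lookup v q))

    half-openᵥ-definable : ∀ w p q → Definable M 3 (HalfOpenᵥ w p q)
    half-openᵥ-definable w p q = at (half-open-definable w) p q

    Turns : ℤ → ℤ → ℤ → ℕ → ℕ → ℕ → Pred (Vec (Structure.Carrier M) 3) 0ℓ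
    Turns z t k i j l v = fromℤ (+ i) + fromℤ (+ j) + fromℤ (+ l) < L ×
      HalfOpenᵥ (z ℤ.- t ℤ.+ + i) zero (suc zero) v ×
      HalfOpenᵥ (t ℤ.- k ℤ.+ + j) (suc zero) (suc (suc zero)) v ×
      HalfOpenᵥ (k ℤ.- z ℤ.+ + l) (suc (suc zero)) zero v

    turns-definable : ∀ z t k i j l → Definable M 3 (Turns z t k i j l)
    turns-definable z t k i j l =
      def-× (def-const _)
      (def-× (half-openᵥ-definable (z ℤ.- t ℤ.+ + i) zero (suc zero))
      (def-× (half-openᵥ-definable (t ℤ.- k ℤ.+ + j) (suc zero) (suc (suc zero)))
             (half-openᵥ-definable (k ℤ.- z ℤ.+ + l) (suc (suc zero)) zero)))
    Circuitᵥ : ℕ → ℤ → ℤ → ℤ → Pred (Vec (Structure.Carrier M) 3) 0ℓ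
    Circuitᵥ N z t k v = ∃[ i ] (i ℕ.< N × ∃[ j ] (j ℕ.< N × ∃[ l ] (l ℕ.< N × Turns z t k i j l v)))

    circuit-definable : ∀ N z t k → Definable M 3 (Circuitᵥ N z t k)
    circuit-definable N z t k = def-∃< (λ i → def-∃< (λ j → def-∃< (λ l → turns-definable z t k i j l) N) N) N
    circuit-⇔-resp : ∀ {N} → L ≤ fromℤ (+ N) → ∀ z t k {x y w x′ y′ w′} → x ≡ x′ → y ≡ y′ → w ≡ w′ →
                     Circuit N z t k x y w ⇔ C L (shift L z x′) (shift L t y′) (shift L k w′)
    circuit-⇔-resp {N} L≤N z t k {x} {y} {w} refl refl refl =
      mk⇔ (circuit⇒C {N} z t k {x} {y} {w}) (C⇒circuit {N} L≤N z t k {x} {y} {w})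

    circuit⇔C : ∀ {N} → L ≤ fromℤ (+ N) → ∀ z t k v → Circuitᵥ N z t k v ⇔ C[_,_,_] L S z t k v
    circuit⇔C {N} L≤N z t k v@((x , _) ∷ (y , _) ∷ (w , _) ∷ []) = circuit-⇔-resp {N} L≤N z t k
      {proj₁ (lookup v zero)} {proj₁ (lookup v (suc zero))} {proj₁ (lookup v (suc (suc zero)))} {x} {y} {w} refl refl refl

    C-definable : ∀ z t k → Definable M 3 (C[_,_,_] L S z t k)
    C-definable z t k = let (N , L<N) = archimedean L in
      def-⇔ (circuit⇔C {N} (<⇒≤ {L} {fromℤ (+ N)} L<N) z t k) (circuit-definable N z t k)

-- A step of the loop as an oriented arc

module Steps (em : ExcludedMiddle 0ℓ) (L : ℝ) (3<L : fromℤ (+ 3) < L)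
             (S : Pred ℝ 0ℓ) (dense : Dense L S) where
  open Arcs em L 3<L S dense

  -- Congruent representatives in [0, L) coincide, since otherwise they would differ by at least
  -- `L`; then the distance is 0.
  dist>0⇒≁ : ∀ {a b r} → Dist L a b r → 0ℝ < r → ¬ a ~ b
  dist>0⇒≁ {a} {b} {r} (x , y , (0≤x , x<L , x~a) , (0≤y , y<L , y~b) , r≈m) 0<r a~b =
    case compare x y of λ where
      (inj₁ x<y) → ~-gap-L {y} {x} (~-sym {x} {y} x~y) x<y
        (lin (x ∷ y ∷ L ∷ []) (λ x y L → 𝟎 :≤ x ∷ y :< L ∷ [] ⊢ y ⊖ x :< L) (0≤x , y<L , tt))
      (inj₂ y≤x) → case compare y x of λ where
        (inj₁ y<x) → ~-gap-L {x} {y} x~y y<x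
          (lin (x ∷ y ∷ L ∷ []) (λ x y L → 𝟎 :≤ y ∷ x :< L ∷ [] ⊢ x ⊖ y :< L) (0≤y , x<L , tt))
        (inj₂ x≤y) → lin (r ∷ ∣ x - y ∣ ⊓ (L - ∣ x - y ∣) ∷ ∣ x - y ∣ ∷ [])
          (λ r m D → r :≈ m ∷ m :≤ D ∷ D :≤ 𝟎 ∷ [] ⊢ r :≤ 𝟎)
          (r≈m , ⊓≤∣d∣ (x - y) ,
            ∣∣-≤ {x - y} {0ℝ}
              (lin (x ∷ y ∷ []) (λ x y → x :≤ y ∷ [] ⊢ x ⊖ y :≤ 𝟎) (x≤y , tt))
              (lin (x ∷ y ∷ []) (λ x y → y :≤ x ∷ [] ⊢ ⊝ (x ⊖ y) :≤ 𝟎) (y≤x , tt)) , tt) 0<r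
    where
    x~y : x ~ y
    x~y = lin (x ∷ y ∷ a ∷ b ∷ []) (λ x y a b → x :~ a ∷ a :~ b ∷ b :~ y ∷ [] ⊢ x :~ y)
      (x~a , a~b , ~-sym {y} {b} y~b , tt)

  -- The sign of the offset in (-1, 1) gives the direction; offset 0 is excluded by the positive
  -- distance.
  step⇒arc : ∀ {a b r} → Dist L a b r → 0ℝ < r → r < 1ℝ → Arc a b ⊎ Arc b a
  step⇒arc {a} {b} {r} d 0<r r<1 =
    let (between s -1<s s<1 b~a+s) = dist⇒between {1ℝ} {a} {b} {r} 0<1 d r<1 in
    case compare 0ℝ s of λ where
      (inj₁ 0<s) → inj₁ (between s 0<s s<1 b~a+s)
      (inj₂ s≤0) → case compare s 0ℝ of λ where
        (inj₁ s<0) → inj₂ (between (- s)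
          (lin (s ∷ []) (λ s → s :< 𝟎 ∷ [] ⊢ 𝟎 :< ⊝ s) (s<0 , tt))
          (lin (s ∷ []) (λ s → ⊝ 𝟏 :< s ∷ [] ⊢ ⊝ s :< 𝟏) (-1<s , tt))
          (lin (a ∷ b ∷ s ∷ []) (λ a b s → a ⊕ s :~ b ∷ [] ⊢ a :~ b ⊕ (⊝ s)) (~-sym {b} {a + s} b~a+s , tt)))
        (inj₂ 0≤s) → ⊥-elim (dist>0⇒≁ {a} {b} {r} d 0<r
          (lin (a ∷ b ∷ s ∷ []) (λ a b s → a ⊕ s :~ b ∷ 𝟎 :≈ s ∷ [] ⊢ a :~ b)
            (~-sym {b} {a + s} b~a+s , ≤-antisym {0ℝ} {s} 0≤s s≤0 , tt)))

proposition2p13 :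
    ExcludedMiddle 0ℓ →
    (L : ℝ) → fromℤ (+ 3) < L →
    (m : ℕ) → m IsFloorOf L →
    (S : Pred ℝ 0ℓ) → S Respects SamePoint L → Dense L S →
    (a : Fin (suc (suc m)) → Σ ℝ S) → OrientingLoop L m (proj₁ ∘ a) →
    ((z t k : ℤ) → Definable (structure-S_L L S a) 3 (C[_,_,_] L S z t k)) ×
    ((z : ℤ) → Definable (structure-S_L L S a) 2 (f-graph L S z))
proposition2p13 em L 3<L m _ S _ dense a loop =
  let (r , d , 0<r , r<1) = OrientingLoop.steps loop 0 in
  -- The two constants are taken in the order in which their arc runs positively. This choice is
  -- made while the formula is being built, so no formula has to express it.
  case step⇒arc {cyclic L m (proj₁ ∘ a) 0} {cyclic L m (proj₁ ∘ a) 1} {r} d 0<r r<1 of λ where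
    (inj₁ a₀→a₁) → definable (inject₁ (0 mod suc m)) (inject₁ (1 mod suc m)) a₀→a₁
    (inj₂ a₁→a₀) → definable (inject₁ (1 mod suc m)) (inject₁ (0 mod suc m)) a₁→a₀
  where
  open Arcs em L 3<L S dense using (Arc)
  open Steps em L 3<L S dense
  definable : ∀ c c′ → Arc (proj₁ (a c)) (proj₁ (a c′)) →
    ((z t k : ℤ) → Definable (structure-S_L L S a) 3 (C[_,_,_] L S z t k)) ×
    ((z : ℤ) → Definable (structure-S_L L S a) 2 (f-graph L S z))
  definable c c′ c→c′ = C-definable c→c′ , f-definable c→c′
    where open Constants em L 3<L S dense a c c′
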